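{- For every integer $n\geq 1$, $$T(3,n) = G_n(3,1) + 2\,G_{n-1}(3,0).$$
   Context: The Super-Catalan numbers are $T(m,n) := \frac{1}{2}\cdot\frac{(2m)!\,(2n)!}{m!\,n!\,(m+n)!}$ for integers $m\ge 0$, $n\geq 1$. A Dyck path of length $2\ell$ ($\ell\ge 0$) is a sequence $\pi=(\pi(1),\dots,\pi(2\ell))$ with each $\pi(k)=\pm1$, $\sum_{i=1}^{2\ell}\pi(i)=0$, and $\sum_{i=1}^k\pi(i)\ge 0$ for all $1\le k\le 2\ell$; its length is $|\pi|=2\ell$. Its height is $h(\pi)=\max_k\sum_{i=1}^k\pi(i)$, and the unique Dyck path $\epsilon$ of length $0$ has $h(\epsilon)=0$. For integers $m\ge 1$, $k\ge 0$ and $n$, $G_n(m,k)$ is the number of $m$-tuples $(\pi^{(1)},\dots,\pi^{(m)})$ of Dyck paths with $\sum_{i=1}^m|\pi^{(i)}|=2n$ and $|h(\pi^{(i)})-h(\pi^{(j)})|\le k$ for all $i,j$ (so $G_n(m,k)=0$ for $n<0$). -}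

module Defs where

open import Data.Fin.Base using (Fin)
import Data.Fin.Properties as Fin
open import Data.Integer.Base as ℤ using (ℤ; +_; 0ℤ; 1ℤ; ∣_∣)
import Data.Integer.Properties as ℤ
open import Data.List.Base using (List; []; _∷_; length; map; foldr; inits; upTo; filter; concatMap; cartesianProductWith)
open import Data.List.Membership.Propositional using (_∈_)
open import Data.List.Membership.Propositional.Properties
open import Data.List.Properties using () renaming (∷-injective to ∷-injectiveᴸ)
open import Data.List.Relation.Binary.Disjoint.Propositional using (Disjoint)
open import Data.List.Relation.Unary.All as All using (All; []; _∷_)
import Data.List.Relation.Unary.All.Properties as All
open import Data.List.Relation.Unary.AllPairs as AllPairs using ([]; _∷_)
import Data.List.Relation.Unary.AllPairs.Properties as AllPairs
open import Data.List.Relation.Unary.Any using (here; there)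
import Data.List.Relation.Unary.Any as Any
open import Data.List.Relation.Unary.Unique.Propositional using (Unique)
import Data.List.Relation.Unary.Unique.Propositional.Properties as Unique
open import Data.Nat.Base as ℕ using (ℕ; zero; suc; NonZero; _!)
import Data.Nat.Properties as ℕ
open import Data.Nat.Divisibility using (_∣_; _∣?_)
open import Data.Product using (_×_; _,_; proj₁; proj₂)
open import Data.Rational.Base as ℚ using (ℚ; ½)
open import Data.Sign.Base as Sign using (Sign)
open import Data.Vec.Base as Vec using (Vec; []; _∷_; lookup)
open import Data.Vec.Properties using () renaming (∷-injective to ∷-injectiveⱽ)
import Data.Vec.Relation.Unary.All as VecAll
open import Function.Base using (_∘_)
open import Function.Bundles using (_⇔_; mk⇔)
open import Relation.Binary.PropositionalEquality
open import Relation.Nullary.Decidable using (_×-dec_)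
open import Relation.Unary using (Decidable)

-- The paper takes m ≥ 0 and n ≥ 1; the formula makes sense for all m and n.
T : ℕ → ℕ → ℚ
T m n = ½ ℚ.* ((+ ((2 ℕ.* m) ! ℕ.* (2 ℕ.* n) !)) ℚ./ (m ! ℕ.* n ! ℕ.* (m ℕ.+ n) !))
  where instance
    _ : NonZero (m ! ℕ.* n ! ℕ.* (m ℕ.+ n) !)
    _ = ℕ.m*n≢0 (m ! ℕ.* n !) ((m ℕ.+ n) !) {{m ℕ.!* n !≢0}} {{(m ℕ.+ n) ℕ.!≢0}}

Path : Set
Path = List Sign

step : Sign → ℤ
step Sign.+ = 1ℤ
step Sign.- = ℤ.- 1ℤ

total : Path → ℤ
total π = foldr ℤ._+_ 0ℤ (map step π)

-- All the sums π(1) + ⋯ + π(k), including the empty sum k = 0. The latter is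
-- 0, so it affects neither non-negativity nor, for Dyck paths, the maximum.
partialSums : Path → List ℤ
partialSums π = map total (inits π)

IsDyck : Path → Set
IsDyck π = 2 ∣ length π × total π ≡ 0ℤ × All (0ℤ ℤ.≤_) (partialSums π)

height : Path → ℤ
height π = foldr ℤ._⊔_ 0ℤ (partialSums π)

totalLength : ∀ {m} → Vec Path m → ℕ
totalLength πs = Vec.sum (Vec.map length πs)

-- The tuples counted by Gₙ(m,k), for an arbitrary integer n.
Admissible : ℤ → ∀ {m} → ℕ → Vec Path m → Set
Admissible n {m} k πs =
    VecAll.All IsDyck πs
  × + totalLength πs ≡ + 2 ℤ.* n
  × (∀ (i j : Fin m) → ∣ height (lookup πs i) ℤ.- height (lookup πs j) ∣ ℕ.≤ k)

isDyck? : Decidable IsDyck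
isDyck? π = (2 ∣? length π) ×-dec (total π ℤ.≟ 0ℤ) ×-dec All.all? (0ℤ ℤ.≤?_) (partialSums π)

admissible? : ∀ n {m} k → Decidable (Admissible n {m} k)
admissible? n k πs =
        VecAll.all? isDyck? πs
  ×-dec (+ totalLength πs ℤ.≟ + 2 ℤ.* n)
  ×-dec Fin.all? (λ i → Fin.all? (λ j → ∣ height (lookup πs i) ℤ.- height (lookup πs j) ∣ ℕ.≤? k))

signs : List Sign
signs = Sign.+ ∷ Sign.- ∷ []

pathsOfLength : ℕ → List Path
pathsOfLength zero    = [] ∷ []
pathsOfLength (suc l) = cartesianProductWith _∷_ signs (pathsOfLength l)

pathsUpTo : ℕ → List Path
pathsUpTo l = concatMap pathsOfLength (upTo (suc l))

tuples : ∀ {A : Set} m → List A → List (Vec A m)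
tuples zero    xs = [] ∷ []
tuples (suc m) xs = cartesianProductWith _∷_ xs (tuples m xs)

-- Each entry of an admissible tuple has length at most 2n, so filtering this
-- finite list loses nothing; see ∈-admissibleTuples and admissibleTuples-unique.
admissibleTuples : ℤ → ∀ m → ℕ → List (Vec Path m)
admissibleTuples n m k = filter (admissible? n k) (tuples m (pathsUpTo ∣ + 2 ℤ.* n ∣))

G : ℤ → ℕ → ℕ → ℕ
G n m k = length (admissibleTuples n m k)

∈-signs : ∀ s → s ∈ signs
∈-signs Sign.+ = here refl
∈-signs Sign.- = there (here refl)

∈-pathsOfLength : ∀ π → π ∈ pathsOfLength (length π)
∈-pathsOfLength []      = here refl
∈-pathsOfLength (s ∷ π) = ∈-cartesianProductWith⁺ _∷_ (∈-signs s) (∈-pathsOfLength π)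

∈-pathsOfLength⁻ : ∀ l {π} → π ∈ pathsOfLength l → length π ≡ l
∈-pathsOfLength⁻ zero    (here refl) = refl
∈-pathsOfLength⁻ (suc l) π∈
  with _ , _ , _ , ρ∈ , refl ← ∈-cartesianProductWith⁻ _∷_ signs (pathsOfLength l) π∈
  = cong suc (∈-pathsOfLength⁻ l ρ∈)

∈-pathsUpTo : ∀ {l} π → length π ℕ.≤ l → π ∈ pathsUpTo l
∈-pathsUpTo π π≤l =
  ∈-concatMap⁺ pathsOfLength (Any.map (λ { refl → ∈-pathsOfLength π }) (∈-upTo⁺ (ℕ.s≤s π≤l)))

∈-tuples : ∀ {m l} (πs : Vec Path m) → totalLength πs ℕ.≤ l → πs ∈ tuples m (pathsUpTo l)
∈-tuples []       _  = here refl
∈-tuples (π ∷ πs) le = ∈-cartesianProductWith⁺ _∷_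
  (∈-pathsUpTo π (ℕ.m+n≤o⇒m≤o (length π) le))
  (∈-tuples πs (ℕ.m+n≤o⇒n≤o (length π) le))

∈-admissibleTuples : ∀ n m k (πs : Vec Path m) → πs ∈ admissibleTuples n m k ⇔ Admissible n k πs
∈-admissibleTuples n m k πs = mk⇔
  (λ πs∈ → proj₂ (∈-filter⁻ (admissible? n k) {xs = tuples m (pathsUpTo ∣ + 2 ℤ.* n ∣)} πs∈))
  (λ adm → ∈-filter⁺ (admissible? n k) (∈-tuples πs (ℕ.≤-reflexive (cong ∣_∣ (proj₁ (proj₂ adm))))) adm)

pathsOfLength-unique : ∀ l → Unique (pathsOfLength l)
pathsOfLength-unique zero    = [] ∷ []
pathsOfLength-unique (suc l) = Unique.cartesianProductWith⁺ _∷_ ∷-injectiveᴸ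
  (((λ ()) ∷ []) ∷ [] ∷ []) (pathsOfLength-unique l)

pathsUpTo-unique : ∀ l → Unique (pathsUpTo l)
pathsUpTo-unique l = Unique.concat⁺
  (All.map⁺ (All.universal pathsOfLength-unique (upTo (suc l))))
  (AllPairs.map⁺ (AllPairs.map disjoint (Unique.upTo⁺ (suc l))))
  where
  disjoint : ∀ {i j} → i ≢ j → Disjoint (pathsOfLength i) (pathsOfLength j)
  disjoint i≢j (π∈i , π∈j) = i≢j (trans (sym (∈-pathsOfLength⁻ _ π∈i)) (∈-pathsOfLength⁻ _ π∈j))

tuples-unique : ∀ {A : Set} m {xs : List A} → Unique xs → Unique (tuples m xs)
tuples-unique zero    u = [] ∷ []
tuples-unique (suc m) u = Unique.cartesianProductWith⁺ _∷_ ∷-injectiveⱽ u (tuples-unique m u)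

admissibleTuples-unique : ∀ n m k → Unique (admissibleTuples n m k)
admissibleTuples-unique n m k =
  Unique.filter⁺ (admissible? n k) (tuples-unique m (pathsUpTo-unique ∣ + 2 ℤ.* n ∣))

{-# OPTIONS --safe #-}
module Submission where

-- Let D h be the generating function, by length, of the Dyck paths of height
-- less than h, let u = z², and let C = 1 + u C² be the Catalan series, the limit
-- of D h. The tuples of m paths whose least height is h and whose heights differ
-- by at most k are enumerated by
--   (D (h + k + 1) - D h)ᵐ - (D (h + k + 1) - D (h + 1))ᵐ,
-- so the right-hand side of the theorem is a coefficient of a sum over h of a
-- polynomial in a = D h, b = D (h + 1), c = D (h + 2). Cutting walks at their
-- first visit to 0 gives b = 1 + u a b and c = 1 + u b c. Modulo these relations
-- and the resulting u a c = u a + c - 1 - u c, all mixed products reduce to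
-- polynomials in one variable, and u² times the summand becomes a difference
-- φ(b) + ψ(c) - φ(a) - ψ(b). The sum telescopes to a polynomial in C, whose
-- coefficients are 16 Cₙ - 8 Cₙ₊₁ + Cₙ₊₂ for n ≥ 1. The formula for Cₙ comes from
-- the differential equation satisfied by 1 - 2uC, the square root of 1 - 4u.

open import Defs
open import Algebra.Bundles using (CommutativeRing)
import Algebra.Properties.Semiring.Exp as Exp
import Algebra.Solver.Ring
open import Algebra.Solver.Ring.AlmostCommutativeRing using (fromCommutativeRing; _-Raw-AlmostCommutative⟶_)
open import Data.Bool.Base using (true; false; if_then_else_)
open import Data.Fin.Base using (zero; suc)
import Data.Fin.Properties as Fin
open import Data.Integer.Base as ℤ using (ℤ; +_; 0ℤ; 1ℤ; ∣_∣)
import Data.Integer.Properties as ℤ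
open import Data.Integer.Tactic.RingSolver using (solve-∀)
open import Data.List.Base
  using (List; []; _∷_; _++_; map; foldr; length; filter; inits; applyUpTo; upTo; concatMap; cartesianProductWith)
open import Data.List.Membership.Propositional using (_∈_)
open import Data.List.Properties using (map-∘)
open import Data.List.Relation.Unary.All as All using (All; []; _∷_)
import Data.List.Relation.Unary.All.Properties as All
open import Data.List.Relation.Unary.Any using (here; there)
import Data.Maybe.Base as Maybe
open import Data.Nat.Base as ℕ using (ℕ; zero; suc; z≤n; s≤s; _!; NonZero)
open import Data.Nat.Divisibility using (_∣_; divides; ∣m∣n⇒∣m+n; ∣-refl)
import Data.Nat.Properties as ℕ
open import Data.Product using (_×_; _,_; proj₂; ∃)
open import Data.Rational.Base as ℚ using (_/_)
import Data.Rational.Properties as ℚ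
import Data.Rational.Unnormalised.Base as ℚᵘ
import Data.Rational.Unnormalised.Properties as ℚᵘ
open import Data.Sign.Base as Sign using (Sign)
open import Data.Vec.Base as Vec using (Vec; []; _∷_; lookup)
import Data.Vec.Properties as Vec
open import Data.Vec.Relation.Unary.All as VecAll using ([]; _∷_)
import Data.Vec.Relation.Unary.All.Properties as VecAll
open import Function.Base using (_∘_)
open import Function.Bundles using (_⇔_; mk⇔)
open import Level using (0ℓ)
open import Relation.Binary.PropositionalEquality
  using (_≡_; _≢_; refl; cong; cong₂; sym; trans; subst; subst₂; module ≡-Reasoning)
open import Relation.Nullary using (contradiction)
open import Relation.Nullary.Decidable using (Dec; yes; no; does; does-⇔; dec⇒maybe; map′; _×-dec_)
open import Relation.Unary using (Decidable)

-- Polynomial identities over a commutative ring with integer constants.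

module IntegerAlgebra {c ℓ} (R : CommutativeRing c ℓ)
  (ι : ℤ.+-*-rawRing -Raw-AlmostCommutative⟶ fromCommutativeRing R) where

  open CommutativeRing R hiding (zero) renaming (refl to ≈-refl; sym to ≈-sym; trans to ≈-trans)
  open Exp semiring using (_^_)
  open _-Raw-AlmostCommutative⟶_ ι using (⟦_⟧; 0-homo)
  open Algebra.Solver.Ring ℤ.+-*-rawRing (fromCommutativeRing R) ι
    (λ a b → Maybe.map (λ eq → reflexive (cong ⟦_⟧ eq)) (dec⇒maybe (a ℤ.≟ b))) hiding (⟦_⟧)
  open import Relation.Binary.Reasoning.Setoid setoid

  private
    # : ∀ {n} → ℕ → Polynomial n
    # k = con (+ k)

    -- Syntactic counterparts of `φ`, `ψ` and `summand` for the ring solver; each has to evaluate to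
    -- exactly the expression of its namesake.
    φᵉ : ∀ {n} → Polynomial n → Polynomial n → Polynomial n
    φᵉ u a = (u :* u :+ # 2 :* u :* u :* u) :* a :* a :* a :- # 3 :* u :* u :* a :* a :+ # 12 :* u :* u :* a

    ψᵉ : ∀ {n} → Polynomial n → Polynomial n → Polynomial n
    ψᵉ u a = # 3 :* u :* u :* a :* a :+ (# 6 :* u :* u :- # 9 :* u) :* a

    summandᵉ : ∀ {n} → Polynomial n → Polynomial n → Polynomial n → Polynomial n → Polynomial n
    summandᵉ u a b c = (c :- a) :^ 3 :- (c :- b) :^ 3 :+ # 2 :* u :* ((b :- a) :^ 3 :- (b :- b) :^ 3)

  -- The two parts of the telescoping potential `φ u (D h) + ψ u (D (h + 1))`, where D h is the
  -- series of paths of height less than h. The coefficients are chosen so that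
  -- `u * u * summand u a b c` is an exact difference modulo the two recurrences.
  φ ψ : Carrier → Carrier → Carrier
  φ u a = (u * u + ⟦ + 2 ⟧ * u * u * u) * a * a * a - ⟦ + 3 ⟧ * u * u * a * a + ⟦ + 12 ⟧ * u * u * a
  ψ u a = ⟦ + 3 ⟧ * u * u * a * a + (⟦ + 6 ⟧ * u * u - ⟦ + 9 ⟧ * u) * a

  -- The cube of b - b = 0 is kept to match gfTerm 3 0.
  summand : Carrier → Carrier → Carrier → Carrier → Carrier
  summand u a b c = (c - a) ^ 3 - (c - b) ^ 3 + ⟦ + 2 ⟧ * u * ((b - a) ^ 3 - (b - b) ^ 3)

  -- The factor of C₃ is u a c - u a - c + 1 + u c up to sign, the relation between
  -- a and c implied by ρ₁ = ρ₂ = 0.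
  summand-identity : ∀ u a b c →
    let ρ₁ = b - ⟦ + 1 ⟧ - u * a * b; ρ₂ = c - ⟦ + 1 ⟧ - u * b * c
        C₁ = ⟦ + 6 ⟧ * u * u * (b - a) - ⟦ + 6 ⟧ * u
        C₂ = ⟦ + 3 ⟧ + ⟦ + 3 ⟧ * u * b - ⟦ + 3 ⟧ * u * c
        C₃ = ⟦ + 3 ⟧ * u * c - ⟦ + 3 ⟧ * u * a + ⟦ + 6 ⟧ * u - ⟦ + 3 ⟧ in
    u * u * summand u a b c ≈ (φ u b + ψ u c) - (φ u a + ψ u b)
       + (C₁ * ρ₁ + C₂ * ρ₂ + C₃ * (u * c * ρ₁ + (⟦ + 1 ⟧ - u * a) * ρ₂))
  summand-identity = solve 4 (λ u a b c →
    let ρ₁ = b :- # 1 :- u :* a :* b; ρ₂ = c :- # 1 :- u :* b :* c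
        C₁ = # 6 :* u :* u :* (b :- a) :- # 6 :* u
        C₂ = # 3 :+ # 3 :* u :* b :- # 3 :* u :* c
        C₃ = # 3 :* u :* c :- # 3 :* u :* a :+ # 6 :* u :- # 3 in
    u :* u :* summandᵉ u a b c := (φᵉ u b :+ ψᵉ u c) :- (φᵉ u a :+ ψᵉ u b)
       :+ (C₁ :* ρ₁ :+ C₂ :* ρ₂ :+ C₃ :* (u :* c :* ρ₁ :+ (# 1 :- u :* a) :* ρ₂))) ≈-refl

  private
    vanish : ∀ {x y} → x ≈ ⟦ 1ℤ ⟧ + y → x - ⟦ 1ℤ ⟧ - y ≈ 0#
    vanish {x} {y} eq = begin
      x - ⟦ 1ℤ ⟧ - y               ≈⟨ +-congʳ (+-congʳ eq) ⟩
      ⟦ 1ℤ ⟧ + y - ⟦ 1ℤ ⟧ - y      ≈⟨ solve 1 (λ y → # 1 :+ y :- # 1 :- y := # 0) ≈-refl y ⟩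
      ⟦ 0ℤ ⟧                       ≈⟨ 0-homo ⟩
      0#                           ∎

    *-vanish : ∀ x {y} → y ≈ 0# → x * y ≈ 0#
    *-vanish x y≈0 = ≈-trans (*-congˡ y≈0) (zeroʳ x)

    +-vanish : ∀ {x y} → x ≈ 0# → y ≈ 0# → x + y ≈ 0#
    +-vanish x≈0 y≈0 = ≈-trans (+-cong x≈0 y≈0) (+-identityʳ 0#)

    -- The solver proves x = y + z as polynomials, with z an explicit multiple of the relations; z
    -- then vanishes at elements that satisfy them.
    drop : ∀ {x y z} → x ≈ y + z → z ≈ 0# → x ≈ y
    drop x≈y+z z≈0 = ≈-trans x≈y+z (≈-trans (+-congˡ z≈0) (+-identityʳ _))

  summand-difference : ∀ u a b c → b ≈ ⟦ 1ℤ ⟧ + u * a * b → c ≈ ⟦ 1ℤ ⟧ + u * b * c →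
    u * u * summand u a b c ≈ (φ u b + ψ u c) - (φ u a + ψ u b)
  summand-difference u a b c b≈ c≈ = drop (summand-identity u a b c)
    (+-vanish (+-vanish (*-vanish _ ρ₁≈0) (*-vanish _ ρ₂≈0))
              (*-vanish _ (+-vanish (*-vanish _ ρ₁≈0) (*-vanish _ ρ₂≈0))))
    where
    ρ₁≈0 = vanish b≈
    ρ₂≈0 = vanish c≈

  -- The squares in `φ u C` and `ψ u C` cancel, and C = 1 + uC² reduces the cubic term to a linear
  -- one. The arguments 0 and 1 subtracted on the left are the values of D 0 and D 1.
  limit-identity : ∀ u C → C ≈ ⟦ 1ℤ ⟧ + u * C * C →
    (φ u C + ψ u C) - (φ u ⟦ 0ℤ ⟧ + ψ u ⟦ 1ℤ ⟧) ≈
    C - ⟦ + 8 ⟧ * (u * C) + ⟦ + 16 ⟧ * (u * (u * C)) + (⟦ + 7 ⟧ * u - ⟦ 1ℤ ⟧ - ⟦ + 9 ⟧ * (u * u))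
  limit-identity u C C≈ = drop
    (solve 2 (λ u C →
      (φᵉ u C :+ ψᵉ u C) :- (φᵉ u (# 0) :+ ψᵉ u (# 1)) :=
      C :- # 8 :* (u :* C) :+ # 16 :* (u :* (u :* C)) :+ (# 7 :* u :- # 1 :- # 9 :* (u :* u))
        -- The cofactor is the quotient in the division of the cubic by C - 1 - uC².
        :+ (:- ((# 1 :+ # 2 :* u) :* (u :* C :+ # 1))) :* (C :- # 1 :- u :* C :* C)) ≈-refl u C)
    (*-vanish _ (vanish C≈))

  -- Completing the square in uC² - C + 1 = 0, whose discriminant is 1 - 4u.
  discriminant-identity : ∀ u C → C ≈ ⟦ 1ℤ ⟧ + u * C * C →
    (⟦ 1ℤ ⟧ - ⟦ + 2 ⟧ * (u * C)) * (⟦ 1ℤ ⟧ - ⟦ + 2 ⟧ * (u * C)) ≈ ⟦ 1ℤ ⟧ - ⟦ + 4 ⟧ * u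
  discriminant-identity u C C≈ = drop
    (solve 2 (λ u C →
      (# 1 :- # 2 :* (u :* C)) :* (# 1 :- # 2 :* (u :* C)) :=
      # 1 :- # 4 :* u :+ (:- (# 4 :* u)) :* (C :- # 1 :- u :* C :* C)) ≈-refl u C)
    (*-vanish _ (vanish C≈))

  -- With t the derivative of s, the bracket is the derivative of s² as the Leibniz rule produces
  -- it.
  double-square : ∀ s t → ⟦ + 2 ⟧ * (s * s * t) ≈ (t * s + s * t) * s
  double-square = solve 2 (λ s t → # 2 :* (s :* s :* t) := (t :* s :+ s :* t) :* s) ≈-refl

  -- This and `disc-ode-right` leave only constants times f or `u * f`, whose coefficients can be
  -- read off when u is z².
  disc-ode-left : ∀ u f → ⟦ + 2 ⟧ * ((⟦ 1ℤ ⟧ - ⟦ + 4 ⟧ * u) * f) ≈ ⟦ + 2 ⟧ * (f - ⟦ + 4 ⟧ * (u * f))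
  disc-ode-left = solve 2 (λ u f → # 2 :* ((# 1 :- # 4 :* u) :* f) := # 2 :* (f :- # 4 :* (u :* f))) ≈-refl

  disc-ode-right : ∀ u f → - (⟦ + 8 ⟧ * u) * f ≈ - (⟦ + 8 ⟧ * (u * f))
  disc-ode-right = solve 2 (λ u f → :- (# 8 :* u) :* f := :- (# 8 :* (u :* f))) ≈-refl

-- Finite sums over lists, used both for integers and for power series.

module ListSum {c ℓ} (R : CommutativeRing c ℓ) where
  open CommutativeRing R hiding (zero) renaming (refl to ≈-refl; sym to ≈-sym; trans to ≈-trans)
  open import Algebra.Properties.CommutativeSemigroup +-commutativeSemigroup using (interchange)
  open import Algebra.Properties.AbelianGroup +-abelianGroup using (⁻¹-∙-comm)
  open import Algebra.Properties.Group +-group using (ε⁻¹≈ε)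
  open import Relation.Binary.Reasoning.Setoid setoid

  private variable
    A B : Set

  ∑ : (A → Carrier) → List A → Carrier
  ∑ f []       = 0#
  ∑ f (x ∷ xs) = f x + ∑ f xs

  ∑-cong-∈ : ∀ {f g : A → Carrier} xs → (∀ {x} → x ∈ xs → f x ≈ g x) → ∑ f xs ≈ ∑ g xs
  ∑-cong-∈ []       eq = ≈-refl
  ∑-cong-∈ (x ∷ xs) eq = +-cong (eq (here refl)) (∑-cong-∈ xs (λ x∈ → eq (there x∈)))

  ∑-cong : ∀ {f g : A → Carrier} xs → (∀ x → f x ≈ g x) → ∑ f xs ≈ ∑ g xs
  ∑-cong xs eq = ∑-cong-∈ xs (λ {x} _ → eq x)

  ∑-zero : ∀ (xs : List A) → ∑ (λ _ → 0#) xs ≈ 0#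
  ∑-zero []       = ≈-refl
  ∑-zero (x ∷ xs) = ≈-trans (+-identityˡ _) (∑-zero xs)

  ∑-+ : ∀ (f g : A → Carrier) xs → ∑ (λ x → f x + g x) xs ≈ ∑ f xs + ∑ g xs
  ∑-+ f g []       = ≈-sym (+-identityʳ 0#)
  ∑-+ f g (x ∷ xs) = ≈-trans (+-congˡ (∑-+ f g xs)) (interchange _ _ _ _)

  ∑-neg : ∀ (f : A → Carrier) xs → ∑ (λ x → - f x) xs ≈ - ∑ f xs
  ∑-neg f []       = ≈-sym ε⁻¹≈ε
  ∑-neg f (x ∷ xs) = ≈-trans (+-congˡ (∑-neg f xs)) (⁻¹-∙-comm _ _)

  ∑-sub : ∀ (f g : A → Carrier) xs → ∑ (λ x → f x - g x) xs ≈ ∑ f xs - ∑ g xs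
  ∑-sub f g xs = ≈-trans (∑-+ f (λ x → - g x) xs) (+-congˡ (∑-neg g xs))

  *-∑ : ∀ y (f : A → Carrier) xs → y * ∑ f xs ≈ ∑ (λ x → y * f x) xs
  *-∑ y f []       = zeroʳ y
  *-∑ y f (x ∷ xs) = ≈-trans (distribˡ y _ _) (+-congˡ (*-∑ y f xs))

  ∑-* : ∀ (f : A → Carrier) xs y → ∑ f xs * y ≈ ∑ (λ x → f x * y) xs
  ∑-* f []       y = zeroˡ y
  ∑-* f (x ∷ xs) y = ≈-trans (distribʳ y _ _) (+-congˡ (∑-* f xs y))

  ∑-swap : ∀ (f : A → B → Carrier) xs ys →
    ∑ (λ x → ∑ (f x) ys) xs ≈ ∑ (λ y → ∑ (λ x → f x y) xs) ys
  ∑-swap f []       ys = ≈-sym (∑-zero ys)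
  ∑-swap f (x ∷ xs) ys = ≈-trans (+-congˡ (∑-swap f xs ys)) (≈-sym (∑-+ (f x) _ ys))

  ∑-map : ∀ (f : B → Carrier) (g : A → B) xs → ∑ f (map g xs) ≈ ∑ (f ∘ g) xs
  ∑-map f g []       = ≈-refl
  ∑-map f g (x ∷ xs) = +-congˡ (∑-map f g xs)

  ∑-++ : ∀ (f : A → Carrier) xs ys → ∑ f (xs ++ ys) ≈ ∑ f xs + ∑ f ys
  ∑-++ f []       ys = ≈-sym (+-identityˡ _)
  ∑-++ f (x ∷ xs) ys = ≈-trans (+-congˡ (∑-++ f xs ys)) (≈-sym (+-assoc _ _ _))

  ∑-concatMap : ∀ (f : B → Carrier) (g : A → List B) xs → ∑ f (concatMap g xs) ≈ ∑ (λ x → ∑ f (g x)) xs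
  ∑-concatMap f g []       = ≈-refl
  ∑-concatMap f g (x ∷ xs) = ≈-trans (∑-++ f (g x) (concatMap g xs)) (+-congˡ (∑-concatMap f g xs))

  ∑-cartesianProductWith : ∀ {C : Set} (f : C → Carrier) (g : A → B → C) xs ys →
    ∑ f (cartesianProductWith g xs ys) ≈ ∑ (λ x → ∑ (λ y → f (g x y)) ys) xs
  ∑-cartesianProductWith f g []       ys = ≈-refl
  ∑-cartesianProductWith f g (x ∷ xs) ys = begin
    ∑ f (map (g x) ys ++ cartesianProductWith g xs ys)         ≈⟨ ∑-++ f (map (g x) ys) _ ⟩
    ∑ f (map (g x) ys) + ∑ f (cartesianProductWith g xs ys)    ≈⟨ +-cong (∑-map f (g x) ys) (∑-cartesianProductWith f g xs ys) ⟩
    ∑ (f ∘ g x) ys + ∑ (λ x → ∑ (λ y → f (g x y)) ys) xs       ∎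

  ∑-applyUpTo : ∀ (f : A → Carrier) (g : ℕ → A) n → ∑ f (applyUpTo g n) ≈ ∑ (f ∘ g) (upTo n)
  ∑-applyUpTo f g n = go g (λ k → k) n
    where
    -- The index map `i` is generalised because each unfolding of `applyUpTo` precomposes it with
    -- `suc`.
    go : ∀ (g : ℕ → _) (i : ℕ → ℕ) n → ∑ f (applyUpTo (g ∘ i) n) ≈ ∑ (f ∘ g) (applyUpTo i n)
    go g i zero    = ≈-refl
    go g i (suc n) = +-congˡ (go g (i ∘ suc) n)

  ∑-upTo-suc : ∀ (f : ℕ → Carrier) n → ∑ f (upTo (suc n)) ≈ f 0 + ∑ (f ∘ suc) (upTo n)
  ∑-upTo-suc f n = +-congˡ (∑-applyUpTo f suc n)

  ∑-telescope : ∀ (f F : ℕ → Carrier) → (∀ h → f h ≈ F (suc h) - F h) →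
    ∀ n → ∑ f (upTo n) ≈ F n - F 0
  ∑-telescope f F step zero    = ≈-sym (-‿inverseʳ (F 0))
  ∑-telescope f F step (suc n) = begin
    ∑ f (upTo (suc n))                        ≈⟨ ∑-upTo-suc f n ⟩
    f 0 + ∑ (f ∘ suc) (upTo n)                ≈⟨ +-cong (step 0) (∑-telescope (f ∘ suc) (F ∘ suc) (step ∘ suc) n) ⟩
    (F 1 - F 0) + (F (suc n) - F 1)           ≈⟨ +-comm _ _ ⟩
    (F (suc n) - F 1) + (F 1 - F 0)           ≈⟨ +-assoc _ _ _ ⟩
    F (suc n) + (- F 1 + (F 1 - F 0))         ≈⟨ +-congˡ (+-assoc _ _ _) ⟨
    F (suc n) + ((- F 1 + F 1) - F 0)         ≈⟨ +-congˡ (+-congʳ (-‿inverseˡ (F 1))) ⟩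
    F (suc n) + (0# - F 0)                    ≈⟨ +-congˡ (+-identityˡ _) ⟩
    F (suc n) - F 0                           ∎

-- Formal power series

Series : Set
Series = ℕ → ℤ

infix 4 _≈_
-- A record rather than a bare pointwise equality, so that unification can recover the two series
-- from the type.
record _≈_ (f g : Series) : Set where
  constructor coeffwise
  field coeff : ∀ k → f k ≡ g k
open _≈_

infixl 6 _⊕_
infixl 7 _⊛_
infix  8 ⊖_

_⊕_ : Series → Series → Series
(f ⊕ g) k = f k ℤ.+ g k

⊖_ : Series → Series
(⊖ f) k = ℤ.- f k

tail : Series → Series
tail f k = f (suc k)

-- The Cauchy product, computed from f = f 0 + z · `tail f`.
_⊛_ : Series → Series → Series
(f ⊛ g) zero    = f 0 ℤ.* g 0
(f ⊛ g) (suc k) = f 0 ℤ.* g (suc k) ℤ.+ (tail f ⊛ g) k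

const : ℤ → Series
const c zero    = c
const c (suc k) = 0ℤ

-- A coefficient of a product involves no later coefficients of the factors. This is what lets
-- truncated series stand in for limits.
⊛-cong-≤ : ∀ n {f f′ g g′ : Series} → (∀ {k} → k ℕ.≤ n → f k ≡ f′ k) → (∀ {k} → k ℕ.≤ n → g k ≡ g′ k) →
  (f ⊛ g) n ≡ (f′ ⊛ g′) n
⊛-cong-≤ zero    f≡ g≡ = cong₂ ℤ._*_ (f≡ z≤n) (g≡ z≤n)
⊛-cong-≤ (suc n) f≡ g≡ = cong₂ ℤ._+_ (cong₂ ℤ._*_ (f≡ z≤n) (g≡ ℕ.≤-refl))
  (⊛-cong-≤ n (λ k≤n → f≡ (s≤s k≤n)) (λ k≤n → g≡ (ℕ.m≤n⇒m≤1+n k≤n)))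

⊛-cong : ∀ {f f′ g g′} → f ≈ f′ → g ≈ g′ → f ⊛ g ≈ f′ ⊛ g′
⊛-cong f≈ g≈ .coeff n = ⊛-cong-≤ n (λ {k} _ → coeff f≈ k) (λ {k} _ → coeff g≈ k)

0⊛-coeff : ∀ (f g : Series) k → (∀ j → f j ≡ 0ℤ) → (f ⊛ g) k ≡ 0ℤ
0⊛-coeff f g zero    f≡0 = cong (ℤ._* g 0) (f≡0 0)
0⊛-coeff f g (suc k) f≡0 = cong₂ ℤ._+_ (cong (ℤ._* g (suc k)) (f≡0 0)) (0⊛-coeff (tail f) g k (f≡0 ∘ suc))

const-⊛-coeff : ∀ c f k → (const c ⊛ f) k ≡ c ℤ.* f k
const-⊛-coeff c f zero    = refl
const-⊛-coeff c f (suc k) =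
  trans (cong (ℤ._+_ (c ℤ.* f (suc k))) (0⊛-coeff (tail (const c)) f k (λ _ → refl))) (ℤ.+-identityʳ _)

⊛-distribʳ-coeff : ∀ (f g h : Series) k → ((f ⊕ g) ⊛ h) k ≡ (f ⊛ h) k ℤ.+ (g ⊛ h) k
⊛-distribʳ-coeff f g h zero    = ℤ.*-distribʳ-+ (h 0) (f 0) (g 0)
⊛-distribʳ-coeff f g h (suc k) = trans
  (cong (ℤ._+_ ((f 0 ℤ.+ g 0) ℤ.* h (suc k))) (⊛-distribʳ-coeff (tail f) (tail g) h k))
  (lemma (f 0) (g 0) (h (suc k)) ((tail f ⊛ h) k) ((tail g ⊛ h) k))
  where
  lemma : ∀ a b c x y → (a ℤ.+ b) ℤ.* c ℤ.+ (x ℤ.+ y) ≡ (a ℤ.* c ℤ.+ x) ℤ.+ (b ℤ.* c ℤ.+ y)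
  lemma = solve-∀

scale-⊛-coeff : ∀ c (f g : Series) k → ((λ j → c ℤ.* f j) ⊛ g) k ≡ c ℤ.* (f ⊛ g) k
scale-⊛-coeff c f g zero    = ℤ.*-assoc c (f 0) (g 0)
scale-⊛-coeff c f g (suc k) = trans
  (cong (ℤ._+_ (c ℤ.* f 0 ℤ.* g (suc k))) (scale-⊛-coeff c (tail f) g k))
  (lemma c (f 0) (g (suc k)) ((tail f ⊛ g) k))
  where
  lemma : ∀ c a b x → c ℤ.* a ℤ.* b ℤ.+ c ℤ.* x ≡ c ℤ.* (a ℤ.* b ℤ.+ x)
  lemma = solve-∀

-- The mirror image of the defining recursion, peeling the second factor; comparing the two gives
-- commutativity.
⊛-suc-last : ∀ (f g : Series) k → (f ⊛ g) (suc k) ≡ f (suc k) ℤ.* g 0 ℤ.+ (f ⊛ tail g) k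
⊛-suc-last f g zero    = ℤ.+-comm (f 0 ℤ.* g 1) (f 1 ℤ.* g 0)
⊛-suc-last f g (suc k) = trans
  (cong (ℤ._+_ (f 0 ℤ.* g (2 ℕ.+ k))) (⊛-suc-last (tail f) g k))
  (lemma (f 0 ℤ.* g (2 ℕ.+ k)) (f (2 ℕ.+ k) ℤ.* g 0) ((tail f ⊛ tail g) k))
  where
  lemma : ∀ a b x → a ℤ.+ (b ℤ.+ x) ≡ b ℤ.+ (a ℤ.+ x)
  lemma = solve-∀

⊛-comm-coeff : ∀ (f g : Series) k → (f ⊛ g) k ≡ (g ⊛ f) k
⊛-comm-coeff f g zero    = ℤ.*-comm (f 0) (g 0)
⊛-comm-coeff f g (suc k) = trans
  (cong₂ ℤ._+_ (ℤ.*-comm (f 0) (g (suc k))) (⊛-comm-coeff (tail f) g k))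
  (sym (⊛-suc-last g f k))

⊛-assoc-coeff : ∀ (f g h : Series) k → ((f ⊛ g) ⊛ h) k ≡ (f ⊛ (g ⊛ h)) k
⊛-assoc-coeff f g h zero    = ℤ.*-assoc (f 0) (g 0) (h 0)
⊛-assoc-coeff f g h (suc k) = begin
  f 0 ℤ.* g 0 ℤ.* h (suc k) ℤ.+ (tail (f ⊛ g) ⊛ h) k
    -- By definition `tail (f ⊛ g)` is f 0 times `tail g`, plus `tail f ⊛ g`; distributivity then
    -- exposes the induction hypothesis for `tail f`.
    ≡⟨ cong (ℤ._+_ (f 0 ℤ.* g 0 ℤ.* h (suc k))) (trans
         (⊛-cong-≤ k {f′ = (λ j → f 0 ℤ.* tail g j) ⊕ (tail f ⊛ g)} (λ _ → refl) (λ _ → refl))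
         (⊛-distribʳ-coeff (λ j → f 0 ℤ.* tail g j) (tail f ⊛ g) h k)) ⟩
  f 0 ℤ.* g 0 ℤ.* h (suc k) ℤ.+ (((λ j → f 0 ℤ.* tail g j) ⊛ h) k ℤ.+ ((tail f ⊛ g) ⊛ h) k)
    ≡⟨ cong (ℤ._+_ (f 0 ℤ.* g 0 ℤ.* h (suc k)))
         (cong₂ ℤ._+_ (scale-⊛-coeff (f 0) (tail g) h k) (⊛-assoc-coeff (tail f) g h k)) ⟩
  f 0 ℤ.* g 0 ℤ.* h (suc k) ℤ.+ (f 0 ℤ.* (tail g ⊛ h) k ℤ.+ (tail f ⊛ (g ⊛ h)) k)
    ≡⟨ lemma (f 0) (g 0) (h (suc k)) _ _ ⟩
  f 0 ℤ.* (g 0 ℤ.* h (suc k) ℤ.+ (tail g ⊛ h) k) ℤ.+ (tail f ⊛ (g ⊛ h)) k ∎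
  where
  open ≡-Reasoning
  lemma : ∀ a b c x y → a ℤ.* b ℤ.* c ℤ.+ (a ℤ.* x ℤ.+ y) ≡ a ℤ.* (b ℤ.* c ℤ.+ x) ℤ.+ y
  lemma = solve-∀

seriesRing : CommutativeRing 0ℓ 0ℓ
seriesRing = record
  { Carrier = Series
  ; _≈_     = _≈_
  ; _+_     = _⊕_
  ; _*_     = _⊛_
  ; -_      = ⊖_
  ; 0#      = const 0ℤ
  ; 1#      = const 1ℤ
  ; isCommutativeRing = record
    { isRing = record
      { +-isAbelianGroup = record
        { isGroup = record
          { isMonoid = record
            { isSemigroup = record
              { isMagma = record
                { isEquivalence = record
                  { refl  = coeffwise λ _ → refl
                  ; sym   = λ f≈g → coeffwise λ k → sym (coeff f≈g k)
                  ; trans = λ f≈g g≈h → coeffwise λ k → trans (coeff f≈g k) (coeff g≈h k)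
                  }
                ; ∙-cong = λ f≈ g≈ → coeffwise λ k → cong₂ ℤ._+_ (coeff f≈ k) (coeff g≈ k)
                }
              ; assoc = λ f g h → coeffwise λ k → ℤ.+-assoc (f k) (g k) (h k)
              }
            ; identity = (λ f → coeffwise λ { zero → ℤ.+-identityˡ _ ; (suc k) → ℤ.+-identityˡ _ })
                       , (λ f → coeffwise λ { zero → ℤ.+-identityʳ _ ; (suc k) → ℤ.+-identityʳ _ })
            }
          ; inverse = (λ f → coeffwise λ { zero → ℤ.+-inverseˡ (f 0) ; (suc k) → ℤ.+-inverseˡ (f (suc k)) })
                    , (λ f → coeffwise λ { zero → ℤ.+-inverseʳ (f 0) ; (suc k) → ℤ.+-inverseʳ (f (suc k)) })
          ; ⁻¹-cong = λ f≈ → coeffwise λ k → cong ℤ.-_ (coeff f≈ k)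
          }
        ; comm = λ f g → coeffwise λ k → ℤ.+-comm (f k) (g k)
        }
      ; *-cong     = ⊛-cong
      ; *-assoc    = λ f g h → coeffwise (⊛-assoc-coeff f g h)
      ; *-identity = (λ f → coeffwise (1⊛-coeff f))
                   , (λ f → coeffwise λ k → trans (⊛-comm-coeff f (const 1ℤ) k) (1⊛-coeff f k))
      ; distrib    = (λ f g h → coeffwise λ k → trans (⊛-comm-coeff f (g ⊕ h) k) (trans
                       (⊛-distribʳ-coeff g h f k)
                       (cong₂ ℤ._+_ (⊛-comm-coeff g f k) (⊛-comm-coeff h f k))))
                   , (λ f g h → coeffwise (⊛-distribʳ-coeff g h f))
      }
    ; *-comm = λ f g → coeffwise (⊛-comm-coeff f g)
    }
  }
  where
  1⊛-coeff : ∀ f k → (const 1ℤ ⊛ f) k ≡ f k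
  1⊛-coeff f k = trans (const-⊛-coeff 1ℤ f k) (ℤ.*-identityˡ (f k))

const-homomorphism : ℤ.+-*-rawRing -Raw-AlmostCommutative⟶ fromCommutativeRing seriesRing
const-homomorphism = record
  { ⟦_⟧    = const
  ; +-homo = λ a b → coeffwise λ { zero → refl ; (suc k) → refl }
  ; *-homo = λ a b → coeffwise λ { zero → refl ; (suc k) →
        sym (trans (const-⊛-coeff a (const b) (suc k)) (ℤ.*-zeroʳ a)) }
  ; -‿homo = λ a → coeffwise λ { zero → refl ; (suc k) → refl }
  ; 0-homo = coeffwise λ _ → refl
  ; 1-homo = coeffwise λ _ → refl
  }

-- The Euler operator z d/dz.
θ : Series → Series
θ f k = + k ℤ.* f k

-- The Leibniz rule. In the induction the shift of the exponent by one is absorbed by `tail (θ f)` =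
-- `tail f` + `θ (tail f)`, which is `lemma₃`.
θ-⊛-coeff : ∀ (f g : Series) k → θ (f ⊛ g) k ≡ (θ f ⊛ g) k ℤ.+ (f ⊛ θ g) k
θ-⊛-coeff f g zero    = lemma (f 0) (g 0)
  where
  lemma : ∀ a b → 0ℤ ℤ.* (a ℤ.* b) ≡ 0ℤ ℤ.* a ℤ.* b ℤ.+ a ℤ.* (0ℤ ℤ.* b)
  lemma = solve-∀
θ-⊛-coeff f g (suc k) = begin
  + suc k ℤ.* (f 0 ℤ.* g (suc k) ℤ.+ (tail f ⊛ g) k)
    ≡⟨ lemma₁ (+ k) (f 0 ℤ.* g (suc k)) ((tail f ⊛ g) k) ⟩
  + suc k ℤ.* (f 0 ℤ.* g (suc k)) ℤ.+ ((tail f ⊛ g) k ℤ.+ θ (tail f ⊛ g) k)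
    ≡⟨ cong (λ x → + suc k ℤ.* (f 0 ℤ.* g (suc k)) ℤ.+ ((tail f ⊛ g) k ℤ.+ x)) (θ-⊛-coeff (tail f) g k) ⟩
  + suc k ℤ.* (f 0 ℤ.* g (suc k)) ℤ.+ ((tail f ⊛ g) k ℤ.+ ((θ (tail f) ⊛ g) k ℤ.+ (tail f ⊛ θ g) k))
    ≡⟨ lemma₂ (+ suc k) (f 0) (g (suc k)) ((tail f ⊛ g) k) ((θ (tail f) ⊛ g) k) ((tail f ⊛ θ g) k) ⟩
  0ℤ ℤ.* f 0 ℤ.* g (suc k) ℤ.+ ((tail f ⊛ g) k ℤ.+ (θ (tail f) ⊛ g) k) ℤ.+ (f ⊛ θ g) (suc k)
    ≡⟨ cong (λ x → 0ℤ ℤ.* f 0 ℤ.* g (suc k) ℤ.+ x ℤ.+ (f ⊛ θ g) (suc k)) (trans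
         (sym (⊛-distribʳ-coeff (tail f) (θ (tail f)) g k))
         (⊛-cong-≤ k {f′ = tail (θ f)} {g′ = g} (λ {j} _ → lemma₃ (+ j) (f (suc j))) (λ _ → refl))) ⟩
  (θ f ⊛ g) (suc k) ℤ.+ (f ⊛ θ g) (suc k) ∎
  where
  open ≡-Reasoning
  lemma₁ : ∀ k a b → (1ℤ ℤ.+ k) ℤ.* (a ℤ.+ b) ≡ (1ℤ ℤ.+ k) ℤ.* a ℤ.+ (b ℤ.+ k ℤ.* b)
  lemma₁ = solve-∀
  lemma₂ : ∀ k a b x y z → k ℤ.* (a ℤ.* b) ℤ.+ (x ℤ.+ (y ℤ.+ z))
    ≡ 0ℤ ℤ.* a ℤ.* b ℤ.+ (x ℤ.+ y) ℤ.+ (a ℤ.* (k ℤ.* b) ℤ.+ z)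
  lemma₂ = solve-∀
  lemma₃ : ∀ j a → a ℤ.+ j ℤ.* a ≡ (1ℤ ℤ.+ j) ℤ.* a
  lemma₃ = solve-∀

shift : Series → Series
shift f zero    = 0ℤ
shift f (suc k) = f k

monomial : ℕ → Series
monomial zero    = const 1ℤ
monomial (suc l) = shift (monomial l)

shift-⊛ : ∀ f g → shift f ⊛ g ≈ shift (f ⊛ g)
shift-⊛ f g .coeff zero    = refl
shift-⊛ f g .coeff (suc k) = ℤ.+-identityˡ _

monomial-+ : ∀ a b → monomial (a ℕ.+ b) ≈ monomial a ⊛ monomial b
monomial-+ zero    b = ≈-sym (*-identityˡ (monomial b))
  where open CommutativeRing seriesRing using (*-identityˡ) renaming (sym to ≈-sym)
monomial-+ (suc a) b .coeff zero    = refl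
monomial-+ (suc a) b .coeff (suc k) = trans (coeff (monomial-+ a b) k)
  (sym (coeff (shift-⊛ (monomial a) (monomial b)) (suc k)))

-- Series are indexed by path length, so the variable u of the identities becomes z².
z² : Series
z² = monomial 2

z²-⊛-coeff : ∀ f k → (z² ⊛ f) (2 ℕ.+ k) ≡ f k
z²-⊛-coeff f k = begin
  (z² ⊛ f) (2 ℕ.+ k)           ≡⟨ coeff (shift-⊛ (monomial 1) f) (2 ℕ.+ k) ⟩
  (monomial 1 ⊛ f) (suc k)     ≡⟨ coeff (shift-⊛ (monomial 0) f) (suc k) ⟩
  (monomial 0 ⊛ f) k           ≡⟨ const-⊛-coeff 1ℤ f k ⟩
  1ℤ ℤ.* f k                   ≡⟨ ℤ.*-identityˡ (f k) ⟩
  f k                          ∎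
  where open ≡-Reasoning

module SR = CommutativeRing seriesRing
module ∑ˢ = ListSum seriesRing
module ∑ᶻ = ListSum ℤ.+-*-commutativeRing
open IntegerAlgebra seriesRing const-homomorphism
open import Algebra.Properties.CommutativeSemigroup SR.*-commutativeSemigroup using (interchange)
open import Algebra.Properties.Semiring.Exp SR.semiring using (_^_; ^-cong)

-- Walks with a ceiling

-- descents i j l counts the walks of length l from height i to height 0 that
-- stay between 0 and i + j; thus j is the room left above the walk.
descents : ℕ → ℕ → Series
descents zero    j       zero    = 1ℤ
descents (suc i) j       zero    = 0ℤ
descents zero    zero    (suc l) = 0ℤ
descents zero    (suc j) (suc l) = descents 1 j l
descents (suc i) zero    (suc l) = descents i 1 l
descents (suc i) (suc j) (suc l) = descents (2 ℕ.+ i) j l ℤ.+ descents i (2 ℕ.+ j) l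

-- Cut a walk from height i + 1 at its first visit to height 0.
descents-first-visit : ∀ i j c l → suc i ℕ.+ j ≡ c →
  descents (suc i) j (suc l) ≡ (descents i j ⊛ descents 0 c) l
descents-first-visit zero    zero    c zero    _    = refl
descents-first-visit zero    (suc j) c zero    _    = refl
descents-first-visit (suc i) zero    c zero    _    = refl
descents-first-visit (suc i) (suc j) c zero    _    = refl
descents-first-visit zero zero c (suc l) refl = sym (trans
  (cong₂ ℤ._+_ (ℤ.*-identityˡ (descents 0 1 (suc l))) (0⊛-coeff _ (descents 0 1) l (λ _ → refl)))
  (ℤ.+-identityʳ _))
descents-first-visit zero (suc j) c (suc l) refl = begin
  descents 2 j (suc l) ℤ.+ descents 0 c (suc l)
    ≡⟨ ℤ.+-comm (descents 2 j (suc l)) _ ⟩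
  descents 0 c (suc l) ℤ.+ descents 2 j (suc l)
    ≡⟨ cong₂ ℤ._+_ (sym (ℤ.*-identityˡ (descents 0 c (suc l)))) (descents-first-visit 1 j c l refl) ⟩
  1ℤ ℤ.* descents 0 c (suc l) ℤ.+ (descents 1 j ⊛ descents 0 c) l ∎
  where open ≡-Reasoning
descents-first-visit (suc i) zero c (suc l) eq = trans
  (descents-first-visit i 1 c l (trans (ℕ.+-suc (suc i) 0) eq))
  (sym (ℤ.+-identityˡ _))
descents-first-visit (suc i) (suc j) c (suc l) eq = begin
  descents (3 ℕ.+ i) j (suc l) ℤ.+ descents (suc i) (2 ℕ.+ j) (suc l)
    ≡⟨ cong₂ ℤ._+_
         (descents-first-visit (2 ℕ.+ i) j c l (trans (sym (ℕ.+-suc (2 ℕ.+ i) j)) eq))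
         (descents-first-visit i (2 ℕ.+ j) c l (trans (ℕ.+-suc (suc i) (suc j)) eq)) ⟩
  (descents (2 ℕ.+ i) j ⊛ descents 0 c) l ℤ.+ (descents i (2 ℕ.+ j) ⊛ descents 0 c) l
    ≡⟨ ⊛-distribʳ-coeff (descents (2 ℕ.+ i) j) (descents i (2 ℕ.+ j)) (descents 0 c) l ⟨
  ((descents (2 ℕ.+ i) j ⊕ descents i (2 ℕ.+ j)) ⊛ descents 0 c) l
    ≡⟨ ℤ.+-identityˡ _ ⟨
  (descents (suc i) (suc j) ⊛ descents 0 c) (suc l) ∎
  where open ≡-Reasoning

-- A walk of length l rises at most l above its start, so it never feels a ceiling that is at least
-- l away.
descents-stable-suc : ∀ i j l → l ℕ.≤ j → descents i (suc j) l ≡ descents i j l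
descents-stable-suc zero    j       zero    _       = refl
descents-stable-suc (suc i) j       zero    _       = refl
descents-stable-suc zero    (suc j) (suc l) (s≤s p) = descents-stable-suc 1 j l p
descents-stable-suc (suc i) (suc j) (suc l) (s≤s p) = cong₂ ℤ._+_
  (descents-stable-suc (2 ℕ.+ i) j l p)
  (descents-stable-suc i (2 ℕ.+ j) l (ℕ.m≤n⇒m≤o+n 2 p))

descents-stable : ∀ i j l → l ℕ.≤ j → descents i j l ≡ descents i l l
descents-stable i j l l≤j = go (ℕ.≤⇒≤′ l≤j)
  where
  go : ∀ {j} → l ℕ.≤′ j → descents i j l ≡ descents i l l
  go ℕ.≤′-refl       = refl
  go (ℕ.≤′-step l≤j) = trans (descents-stable-suc i _ l (ℕ.≤′⇒≤ l≤j)) (go l≤j)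

-- The generating function of the Dyck paths of height less than h; the strict
-- bound makes the natural initial value 0.
dyckBelow : ℕ → Series
dyckBelow zero    = const 0ℤ
dyckBelow (suc h) = descents 0 h

-- The coefficientwise limit of `dyckBelow`, read off at the first bound where stability is
-- guaranteed. The index is the path length, so the n-th Catalan number is `catalan (2 * n)`.
catalan : Series
catalan k = dyckBelow (suc k) k

dyckBelow-catalan : ∀ {h k} → k ℕ.< h → dyckBelow h k ≡ catalan k
dyckBelow-catalan {suc h} {k} (s≤s k≤h) = descents-stable 0 h k k≤h

private
  1+z²-coeff : ∀ {f} g → f 0 ≡ 1ℤ → f 1 ≡ 0ℤ → (∀ k → f (2 ℕ.+ k) ≡ g k) → f ≈ const 1ℤ ⊕ z² ⊛ g
  1+z²-coeff g f₀ f₁ f₂ .coeff 0             = f₀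
  1+z²-coeff g f₀ f₁ f₂ .coeff 1             = f₁
  1+z²-coeff g f₀ f₁ f₂ .coeff (suc (suc k)) = trans (f₂ k)
    (sym (trans (ℤ.+-identityˡ _) (z²-⊛-coeff g k)))

-- A nonempty path steps up and is cut at its first return to 0. The part before the return runs one
-- level higher and so has one level less of room; z² accounts for the two steps around it.
dyckBelow-suc : ∀ h → dyckBelow (suc h) ≈ const 1ℤ ⊕ z² ⊛ (dyckBelow h ⊛ dyckBelow (suc h))
dyckBelow-suc zero    = 1+z²-coeff _ refl refl λ k →
  sym (0⊛-coeff (const 0ℤ) (descents 0 0) k λ { zero → refl ; (suc _) → refl })
dyckBelow-suc (suc h) = 1+z²-coeff _ refl refl λ k → descents-first-visit 0 h (suc h) k refl

-- The same cut, made for each coefficient under a ceiling so high that both factors already agree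
-- with `catalan` in the range that matters.
catalan-equation : catalan ≈ const 1ℤ ⊕ z² ⊛ (catalan ⊛ catalan)
catalan-equation = 1+z²-coeff _ refl refl λ k → trans
  (descents-first-visit 0 (suc k) (2 ℕ.+ k) k refl)
  (⊛-cong-≤ k (λ j≤k → dyckBelow-catalan (s≤s (ℕ.m≤n⇒m≤1+n j≤k)))
              (λ j≤k → dyckBelow-catalan (s≤s (ℕ.m≤n⇒m≤o+n 2 j≤k))))

-- The Catalan numbers

disc : Series
disc = const 1ℤ ⊕ ⊖ (const (+ 2) ⊛ (z² ⊛ catalan))

z²-*-assoc : ∀ f g → z² ⊛ (f ⊛ g) ≈ z² ⊛ f ⊛ g
z²-*-assoc f g = SR.sym (SR.*-assoc z² f g)

catalan-equation′ : catalan ≈ const 1ℤ ⊕ z² ⊛ catalan ⊛ catalan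
catalan-equation′ = SR.trans catalan-equation (SR.+-congˡ {const 1ℤ} (z²-*-assoc catalan catalan))

disc-suc² : ∀ k → disc (2 ℕ.+ k) ≡ ℤ.- (+ 2 ℤ.* catalan k)
disc-suc² k = trans (ℤ.+-identityˡ _) (cong ℤ.-_
  (trans (const-⊛-coeff (+ 2) (z² ⊛ catalan) (2 ℕ.+ k)) (cong (+ 2 ℤ.*_) (z²-⊛-coeff catalan k))))

θ-cong : ∀ {f g} → f ≈ g → θ f ≈ θ g
θ-cong f≈g .coeff k = cong (+ k ℤ.*_) (coeff f≈g k)

-- The constant is 8 and not 4 because θ differentiates in z.
θ-1-4z² : θ (const 1ℤ ⊕ ⊖ (const (+ 4) ⊛ z²)) ≈ ⊖ (const (+ 8) ⊛ z²)
θ-1-4z² .coeff 0 = refl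
θ-1-4z² .coeff 1 = refl
θ-1-4z² .coeff 2 = refl
θ-1-4z² .coeff (suc (suc (suc k))) = trans
  (cong (λ x → + (3 ℕ.+ k) ℤ.* (0ℤ ℤ.+ ℤ.- x)) (const-⊛-coeff (+ 4) z² (3 ℕ.+ k)))
  (trans (ℤ.*-zeroʳ (+ (3 ℕ.+ k))) (cong ℤ.-_ (sym (const-⊛-coeff (+ 8) z² (3 ℕ.+ k)))))

-- disc² = 1 - 4z² gives disc · θ disc = -4z², hence (1 - 4z²) θ disc = -4z² disc.
disc-ode : const (+ 2) ⊛ ((const 1ℤ ⊕ ⊖ (const (+ 4) ⊛ z²)) ⊛ θ disc) ≈ ⊖ (const (+ 8) ⊛ z²) ⊛ disc
disc-ode = begin
  const (+ 2) ⊛ ((const 1ℤ ⊕ ⊖ (const (+ 4) ⊛ z²)) ⊛ θ disc)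
    ≈⟨ SR.*-congˡ (SR.*-congʳ disc²) ⟨
  const (+ 2) ⊛ (disc ⊛ disc ⊛ θ disc)
    ≈⟨ double-square disc (θ disc) ⟩
  (θ disc ⊛ disc ⊕ disc ⊛ θ disc) ⊛ disc
    ≈⟨ SR.*-congʳ {disc} (coeffwise (θ-⊛-coeff disc disc)) ⟨
  θ (disc ⊛ disc) ⊛ disc
    ≈⟨ SR.*-congʳ (SR.trans (θ-cong disc²) θ-1-4z²) ⟩
  ⊖ (const (+ 8) ⊛ z²) ⊛ disc ∎
  where
  open import Relation.Binary.Reasoning.Setoid SR.setoid
  disc² = discriminant-identity z² catalan catalan-equation′

-- Compare the coefficients of z to the power 4 + k in `disc-ode`. For k = 2n this is twice the
-- classical (n + 2) Cₙ₊₁ = 2 (2n + 1) Cₙ.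
catalan-recurrence : ∀ k → + (4 ℕ.+ k) ℤ.* catalan (2 ℕ.+ k) ≡ + (4 ℕ.* suc k) ℤ.* catalan k
-- The factor -4 combines the 2 in `disc-ode` with the -2 in `disc-suc²`. The term with 16 is added
-- and subtracted to complete the left-hand side of the differential equation.
catalan-recurrence k = ℤ.*-cancelˡ-≡ (ℤ.- (+ 4)) _ _ (begin
  ℤ.- (+ 4) ℤ.* (+ (4 ℕ.+ k) ℤ.* catalan (2 ℕ.+ k))
    ≡⟨ lemma₁ (+ (4 ℕ.+ k)) (+ (2 ℕ.+ k)) (catalan (2 ℕ.+ k)) (catalan k) ⟩
  + 2 ℤ.* (+ (4 ℕ.+ k) ℤ.* ℤ.- (+ 2 ℤ.* catalan (2 ℕ.+ k)) ℤ.+ ℤ.- (+ 4 ℤ.* (+ (2 ℕ.+ k) ℤ.* ℤ.- (+ 2 ℤ.* catalan k))))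
    ℤ.- + 16 ℤ.* + (2 ℕ.+ k) ℤ.* catalan k
    ≡⟨ cong (ℤ._- + 16 ℤ.* + (2 ℕ.+ k) ℤ.* catalan k) (begin
      + 2 ℤ.* (+ (4 ℕ.+ k) ℤ.* ℤ.- (+ 2 ℤ.* catalan (2 ℕ.+ k)) ℤ.+ ℤ.- (+ 4 ℤ.* (+ (2 ℕ.+ k) ℤ.* ℤ.- (+ 2 ℤ.* catalan k))))
        ≡⟨ cong₂ (λ x y → + 2 ℤ.* (+ (4 ℕ.+ k) ℤ.* x ℤ.+ ℤ.- (+ 4 ℤ.* (+ (2 ℕ.+ k) ℤ.* y))))
             (disc-suc² (2 ℕ.+ k)) (disc-suc² k) ⟨
      + 2 ℤ.* (θ disc (4 ℕ.+ k) ℤ.+ ℤ.- (+ 4 ℤ.* θ disc (2 ℕ.+ k)))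
        ≡⟨ lhs (θ disc) (2 ℕ.+ k) ⟨
      (const (+ 2) ⊛ ((const 1ℤ ⊕ ⊖ (const (+ 4) ⊛ z²)) ⊛ θ disc)) (4 ℕ.+ k)
        ≡⟨ coeff disc-ode (4 ℕ.+ k) ⟩
      (⊖ (const (+ 8) ⊛ z²) ⊛ disc) (4 ℕ.+ k)
        ≡⟨ rhs disc (2 ℕ.+ k) ⟩
      ℤ.- (+ 8 ℤ.* disc (2 ℕ.+ k))
        ≡⟨ cong (λ x → ℤ.- (+ 8 ℤ.* x)) (disc-suc² k) ⟩
      ℤ.- (+ 8 ℤ.* ℤ.- (+ 2 ℤ.* catalan k)) ∎) ⟩
  ℤ.- (+ 8 ℤ.* ℤ.- (+ 2 ℤ.* catalan k)) ℤ.- + 16 ℤ.* + (2 ℕ.+ k) ℤ.* catalan k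
    ≡⟨ lemma₂ (+ k) (catalan k) ⟩
  ℤ.- (+ 4) ℤ.* (+ 4 ℤ.* (1ℤ ℤ.+ + k) ℤ.* catalan k)
    ≡⟨ cong (λ x → ℤ.- (+ 4) ℤ.* (x ℤ.* catalan k)) (sym (ℤ.pos-* 4 (suc k))) ⟩
  ℤ.- (+ 4) ℤ.* (+ (4 ℕ.* suc k) ℤ.* catalan k) ∎)
  where
  open ≡-Reasoning
  lemma₁ : ∀ a b x y → ℤ.- (+ 4) ℤ.* (a ℤ.* x) ≡
    + 2 ℤ.* (a ℤ.* ℤ.- (+ 2 ℤ.* x) ℤ.+ ℤ.- (+ 4 ℤ.* (b ℤ.* ℤ.- (+ 2 ℤ.* y)))) ℤ.- + 16 ℤ.* b ℤ.* y
  lemma₁ = solve-∀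
  lemma₂ : ∀ k y → ℤ.- (+ 8 ℤ.* ℤ.- (+ 2 ℤ.* y)) ℤ.- + 16 ℤ.* (+ 2 ℤ.+ k) ℤ.* y
    ≡ ℤ.- (+ 4) ℤ.* (+ 4 ℤ.* (1ℤ ℤ.+ k) ℤ.* y)
  lemma₂ = solve-∀
  lhs : ∀ f k → (const (+ 2) ⊛ ((const 1ℤ ⊕ ⊖ (const (+ 4) ⊛ z²)) ⊛ f)) (2 ℕ.+ k)
    ≡ + 2 ℤ.* (f (2 ℕ.+ k) ℤ.+ ℤ.- (+ 4 ℤ.* f k))
  lhs f k = trans (coeff (disc-ode-left z² f) (2 ℕ.+ k)) (trans
    (const-⊛-coeff (+ 2) (f ⊕ ⊖ (const (+ 4) ⊛ (z² ⊛ f))) (2 ℕ.+ k))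
    (cong (λ x → + 2 ℤ.* (f (2 ℕ.+ k) ℤ.+ ℤ.- x))
          (trans (const-⊛-coeff (+ 4) (z² ⊛ f) (2 ℕ.+ k)) (cong (+ 4 ℤ.*_) (z²-⊛-coeff f k)))))
  rhs : ∀ f k → (⊖ (const (+ 8) ⊛ z²) ⊛ f) (2 ℕ.+ k) ≡ ℤ.- (+ 8 ℤ.* f k)
  rhs f k = trans (coeff (disc-ode-right z² f) (2 ℕ.+ k)) (cong ℤ.-_
    (trans (const-⊛-coeff (+ 8) (z² ⊛ f) (2 ℕ.+ k)) (cong (+ 8 ℤ.*_) (z²-⊛-coeff f k))))

pos-! : ∀ n → + (suc n !) ≡ + suc n ℤ.* + (n !)
pos-! n = ℤ.pos-* (suc n) (n !)

catalan-recurrence-even : ∀ n → + (2 ℕ.+ n) ℤ.* catalan (2 ℕ.* suc n) ≡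
  + 2 ℤ.* + suc (2 ℕ.* n) ℤ.* catalan (2 ℕ.* n)
catalan-recurrence-even n = ℤ.*-cancelˡ-≡ (+ 2) _ _ (begin
  + 2 ℤ.* (+ (2 ℕ.+ n) ℤ.* catalan (2 ℕ.* suc n))
    ≡⟨ cong (λ k → + 2 ℤ.* (+ (2 ℕ.+ n) ℤ.* catalan k)) (ℕ.*-suc 2 n) ⟩
  + 2 ℤ.* (+ (2 ℕ.+ n) ℤ.* catalan (2 ℕ.+ 2 ℕ.* n))
    ≡⟨ ℤ.*-assoc (+ 2) (+ (2 ℕ.+ n)) _ ⟨
  + 2 ℤ.* + (2 ℕ.+ n) ℤ.* catalan (2 ℕ.+ 2 ℕ.* n)
    ≡⟨ cong (ℤ._* catalan (2 ℕ.+ 2 ℕ.* n))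
         (trans (sym (ℤ.pos-* 2 (2 ℕ.+ n))) (cong +_ (ℕ.*-distribˡ-+ 2 2 n))) ⟩
  + (4 ℕ.+ 2 ℕ.* n) ℤ.* catalan (2 ℕ.+ 2 ℕ.* n)
    ≡⟨ catalan-recurrence (2 ℕ.* n) ⟩
  + (4 ℕ.* suc (2 ℕ.* n)) ℤ.* catalan (2 ℕ.* n)
    ≡⟨ cong (ℤ._* catalan (2 ℕ.* n)) (ℤ.pos-* 4 (suc (2 ℕ.* n))) ⟩
  + 4 ℤ.* + suc (2 ℕ.* n) ℤ.* catalan (2 ℕ.* n)
    ≡⟨ lemma (+ suc (2 ℕ.* n)) (catalan (2 ℕ.* n)) ⟩
  + 2 ℤ.* (+ 2 ℤ.* + suc (2 ℕ.* n) ℤ.* catalan (2 ℕ.* n)) ∎)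
  where
  open ≡-Reasoning
  lemma : ∀ a b → + 4 ℤ.* a ℤ.* b ≡ + 2 ℤ.* (+ 2 ℤ.* a ℤ.* b)
  lemma = solve-∀

-- The closed form of the Catalan numbers without division, by induction along the recurrence.
catalan-formula : ∀ n → catalan (2 ℕ.* n) ℤ.* (+ (suc n !) ℤ.* + (n !)) ≡ + ((2 ℕ.* n) !)
catalan-formula zero    = refl
catalan-formula (suc n) = begin
  catalan (2 ℕ.* suc n) ℤ.* (+ ((2 ℕ.+ n) !) ℤ.* + (suc n !))
    ≡⟨ cong₂ (λ x y → catalan (2 ℕ.* suc n) ℤ.* (x ℤ.* y)) (pos-! (suc n)) (pos-! n) ⟩
  catalan (2 ℕ.* suc n) ℤ.* (+ (2 ℕ.+ n) ℤ.* + (suc n !) ℤ.* (+ suc n ℤ.* + (n !)))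
    ≡⟨ lemma₁ (catalan (2 ℕ.* suc n)) (+ (2 ℕ.+ n)) (+ (suc n !)) (+ suc n) (+ (n !)) ⟩
  + (2 ℕ.+ n) ℤ.* catalan (2 ℕ.* suc n) ℤ.* (+ (suc n !) ℤ.* (+ suc n ℤ.* + (n !)))
    ≡⟨ cong (ℤ._* (+ (suc n !) ℤ.* (+ suc n ℤ.* + (n !)))) (catalan-recurrence-even n) ⟩
  + 2 ℤ.* + suc (2 ℕ.* n) ℤ.* catalan (2 ℕ.* n) ℤ.* (+ (suc n !) ℤ.* (+ suc n ℤ.* + (n !)))
    ≡⟨ lemma₂ (+ suc (2 ℕ.* n)) (catalan (2 ℕ.* n)) (+ (suc n !)) (+ suc n) (+ (n !)) ⟩
  + 2 ℤ.* + suc n ℤ.* (+ suc (2 ℕ.* n) ℤ.* (catalan (2 ℕ.* n) ℤ.* (+ (suc n !) ℤ.* + (n !))))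
    ≡⟨ cong₂ (λ x y → x ℤ.* (+ suc (2 ℕ.* n) ℤ.* y))
         (trans (sym (ℤ.pos-* 2 (suc n))) (cong +_ (ℕ.*-suc 2 n))) (catalan-formula n) ⟩
  + (2 ℕ.+ 2 ℕ.* n) ℤ.* (+ suc (2 ℕ.* n) ℤ.* + ((2 ℕ.* n) !))
    ≡⟨ cong (+ (2 ℕ.+ 2 ℕ.* n) ℤ.*_) (pos-! (2 ℕ.* n)) ⟨
  + (2 ℕ.+ 2 ℕ.* n) ℤ.* + (suc (2 ℕ.* n) !)
    ≡⟨ pos-! (suc (2 ℕ.* n)) ⟨
  + ((2 ℕ.+ 2 ℕ.* n) !)
    ≡⟨ cong (λ k → + (k !)) (ℕ.*-suc 2 n) ⟨
  + ((2 ℕ.* suc n) !) ∎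
  where
  open ≡-Reasoning
  lemma₁ : ∀ c a x b y → c ℤ.* (a ℤ.* x ℤ.* (b ℤ.* y)) ≡ a ℤ.* c ℤ.* (x ℤ.* (b ℤ.* y))
  lemma₁ = solve-∀
  lemma₂ : ∀ a c x b y → + 2 ℤ.* a ℤ.* c ℤ.* (x ℤ.* (b ℤ.* y)) ≡ + 2 ℤ.* b ℤ.* (a ℤ.* (c ℤ.* (x ℤ.* y)))
  lemma₂ = solve-∀

-- T(3, n) as a combination of Catalan numbers.

superCatalan₃ : ℕ → ℤ
superCatalan₃ n = catalan (2 ℕ.* (2 ℕ.+ n)) ℤ.- + 8 ℤ.* catalan (2 ℕ.* suc n) ℤ.+ + 16 ℤ.* catalan (2 ℕ.* n)

-- The two factors clear the denominators of the recurrence applied twice. The remaining 4 (2n +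
-- 3)(2n + 1) - 16 (n + 3)(2n + 1) + 16 (n + 3)(n + 2) collapses to 60.
superCatalan₃-catalan : ∀ n → + (3 ℕ.+ n) ℤ.* (+ (2 ℕ.+ n) ℤ.* superCatalan₃ n) ≡ + 60 ℤ.* catalan (2 ℕ.* n)
superCatalan₃-catalan n = begin
  + (3 ℕ.+ n) ℤ.* (+ (2 ℕ.+ n) ℤ.* superCatalan₃ n)
    ≡⟨ lemma₁ (+ n) (catalan (2 ℕ.* n)) (catalan (2 ℕ.* suc n)) (catalan (2 ℕ.* (2 ℕ.+ n))) ⟩
  + (2 ℕ.+ n) ℤ.* (+ (3 ℕ.+ n) ℤ.* catalan (2 ℕ.* (2 ℕ.+ n)))
    ℤ.- + 8 ℤ.* + (3 ℕ.+ n) ℤ.* (+ (2 ℕ.+ n) ℤ.* catalan (2 ℕ.* suc n))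
    ℤ.+ + 16 ℤ.* + (3 ℕ.+ n) ℤ.* + (2 ℕ.+ n) ℤ.* catalan (2 ℕ.* n)
    ≡⟨ cong₂ (λ x y → + (2 ℕ.+ n) ℤ.* x ℤ.- + 8 ℤ.* + (3 ℕ.+ n) ℤ.* y
                ℤ.+ + 16 ℤ.* + (3 ℕ.+ n) ℤ.* + (2 ℕ.+ n) ℤ.* catalan (2 ℕ.* n))
         (trans (catalan-recurrence-even (suc n))
                (cong (λ k → + 2 ℤ.* + suc k ℤ.* catalan (2 ℕ.* suc n)) (ℕ.*-suc 2 n)))
         (catalan-recurrence-even n) ⟩
  + (2 ℕ.+ n) ℤ.* (+ 2 ℤ.* + (3 ℕ.+ 2 ℕ.* n) ℤ.* catalan (2 ℕ.* suc n))
    ℤ.- + 8 ℤ.* + (3 ℕ.+ n) ℤ.* (+ 2 ℤ.* + suc (2 ℕ.* n) ℤ.* catalan (2 ℕ.* n))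
    ℤ.+ + 16 ℤ.* + (3 ℕ.+ n) ℤ.* + (2 ℕ.+ n) ℤ.* catalan (2 ℕ.* n)
    ≡⟨ cong (λ x → x ℤ.- + 8 ℤ.* + (3 ℕ.+ n) ℤ.* (+ 2 ℤ.* + suc (2 ℕ.* n) ℤ.* catalan (2 ℕ.* n))
                ℤ.+ + 16 ℤ.* + (3 ℕ.+ n) ℤ.* + (2 ℕ.+ n) ℤ.* catalan (2 ℕ.* n))
         (trans (lemma₂ (+ (2 ℕ.+ n)) (+ (3 ℕ.+ 2 ℕ.* n)) (catalan (2 ℕ.* suc n)))
                (cong (+ 2 ℤ.* + (3 ℕ.+ 2 ℕ.* n) ℤ.*_) (catalan-recurrence-even n))) ⟩
  + 2 ℤ.* + (3 ℕ.+ 2 ℕ.* n) ℤ.* (+ 2 ℤ.* + suc (2 ℕ.* n) ℤ.* catalan (2 ℕ.* n))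
    ℤ.- + 8 ℤ.* + (3 ℕ.+ n) ℤ.* (+ 2 ℤ.* + suc (2 ℕ.* n) ℤ.* catalan (2 ℕ.* n))
    ℤ.+ + 16 ℤ.* + (3 ℕ.+ n) ℤ.* + (2 ℕ.+ n) ℤ.* catalan (2 ℕ.* n)
    ≡⟨ cong (λ 2n → + 2 ℤ.* (+ 3 ℤ.+ 2n) ℤ.* (+ 2 ℤ.* (1ℤ ℤ.+ 2n) ℤ.* catalan (2 ℕ.* n))
         ℤ.- + 8 ℤ.* + (3 ℕ.+ n) ℤ.* (+ 2 ℤ.* (1ℤ ℤ.+ 2n) ℤ.* catalan (2 ℕ.* n))
         ℤ.+ + 16 ℤ.* + (3 ℕ.+ n) ℤ.* + (2 ℕ.+ n) ℤ.* catalan (2 ℕ.* n)) (ℤ.pos-* 2 n) ⟩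
  _ ≡⟨ lemma₃ (+ n) (catalan (2 ℕ.* n)) ⟩
  + 60 ℤ.* catalan (2 ℕ.* n) ∎
  where
  open ≡-Reasoning
  lemma₁ : ∀ n x y z → (+ 3 ℤ.+ n) ℤ.* ((+ 2 ℤ.+ n) ℤ.* (z ℤ.- + 8 ℤ.* y ℤ.+ + 16 ℤ.* x)) ≡
    (+ 2 ℤ.+ n) ℤ.* ((+ 3 ℤ.+ n) ℤ.* z) ℤ.- + 8 ℤ.* (+ 3 ℤ.+ n) ℤ.* ((+ 2 ℤ.+ n) ℤ.* y)
      ℤ.+ + 16 ℤ.* (+ 3 ℤ.+ n) ℤ.* (+ 2 ℤ.+ n) ℤ.* x
  lemma₁ = solve-∀
  lemma₂ : ∀ a b y → a ℤ.* (+ 2 ℤ.* b ℤ.* y) ≡ + 2 ℤ.* b ℤ.* (a ℤ.* y)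
  lemma₂ = solve-∀
  lemma₃ : ∀ n x →
    + 2 ℤ.* (+ 3 ℤ.+ + 2 ℤ.* n) ℤ.* (+ 2 ℤ.* (1ℤ ℤ.+ + 2 ℤ.* n) ℤ.* x)
    ℤ.- + 8 ℤ.* (+ 3 ℤ.+ n) ℤ.* (+ 2 ℤ.* (1ℤ ℤ.+ + 2 ℤ.* n) ℤ.* x)
    ℤ.+ + 16 ℤ.* (+ 3 ℤ.+ n) ℤ.* (+ 2 ℤ.+ n) ℤ.* x ≡ + 60 ℤ.* x
  lemma₃ = solve-∀

superCatalan₃-formula : ∀ n → superCatalan₃ n ℤ.* (+ ((3 ℕ.+ n) !) ℤ.* + (n !)) ≡ + 60 ℤ.* + ((2 ℕ.* n) !)
superCatalan₃-formula n = begin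
  superCatalan₃ n ℤ.* (+ ((3 ℕ.+ n) !) ℤ.* + (n !))
    ≡⟨ cong (λ x → superCatalan₃ n ℤ.* (x ℤ.* + (n !)))
         (trans (pos-! (2 ℕ.+ n)) (cong (+ (3 ℕ.+ n) ℤ.*_) (pos-! (suc n)))) ⟩
  superCatalan₃ n ℤ.* (+ (3 ℕ.+ n) ℤ.* (+ (2 ℕ.+ n) ℤ.* + (suc n !)) ℤ.* + (n !))
    ≡⟨ lemma (superCatalan₃ n) (+ (3 ℕ.+ n)) (+ (2 ℕ.+ n)) (+ (suc n !)) (+ (n !)) ⟩
  + (3 ℕ.+ n) ℤ.* (+ (2 ℕ.+ n) ℤ.* superCatalan₃ n) ℤ.* (+ (suc n !) ℤ.* + (n !))
    ≡⟨ cong (ℤ._* (+ (suc n !) ℤ.* + (n !))) (superCatalan₃-catalan n) ⟩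
  + 60 ℤ.* catalan (2 ℕ.* n) ℤ.* (+ (suc n !) ℤ.* + (n !))
    ≡⟨ ℤ.*-assoc (+ 60) (catalan (2 ℕ.* n)) _ ⟩
  + 60 ℤ.* (catalan (2 ℕ.* n) ℤ.* (+ (suc n !) ℤ.* + (n !)))
    ≡⟨ cong (+ 60 ℤ.*_) (catalan-formula n) ⟩
  + 60 ℤ.* + ((2 ℕ.* n) !) ∎
  where
  open ≡-Reasoning
  lemma : ∀ v a b x y → v ℤ.* (a ℤ.* (b ℤ.* x) ℤ.* y) ≡ a ℤ.* (b ℤ.* v) ℤ.* (x ℤ.* y)
  lemma = solve-∀

-- Passing to unnormalised rationals turns the equation into cross-multiplication.
½*/ : ∀ i d .{{_ : NonZero d}} g → i ≡ + 2 ℤ.* g ℤ.* + d → ℚ.½ ℚ.* (i ℚ./ d) ≡ g ℚ./ 1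
½*/ i (suc d) g i≡ = ℚ.toℚᵘ-injective (begin
  ℚ.toℚᵘ (ℚ.½ ℚ.* (i ℚ./ suc d))          ≈⟨ ℚ.toℚᵘ-homo-* ℚ.½ (i ℚ./ suc d) ⟩
  ℚᵘ.½ ℚᵘ.* ℚ.toℚᵘ (i ℚ./ suc d)          ≈⟨ ℚᵘ.*-congˡ {ℚᵘ.½} (ℚ.toℚᵘ-fromℚᵘ (ℚᵘ.mkℚᵘ i d)) ⟩
  ℚᵘ.½ ℚᵘ.* ℚᵘ.mkℚᵘ i d                   ≈⟨ ℚᵘ.*≡* (trans (cong (λ i → 1ℤ ℤ.* i ℤ.* 1ℤ) i≡)
      (trans (lemma g (+ suc d)) (cong (g ℤ.*_) (sym (ℤ.pos-* 2 (suc d)))))) ⟩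
  ℚᵘ.mkℚᵘ g 0                             ≈⟨ ℚ.toℚᵘ-fromℚᵘ (ℚᵘ.mkℚᵘ g 0) ⟨
  ℚ.toℚᵘ (g ℚ./ 1)                        ∎)
  where
  open ℚᵘ.≃-Reasoning
  lemma : ∀ g d → 1ℤ ℤ.* (+ 2 ℤ.* g ℤ.* d) ℤ.* 1ℤ ≡ g ℤ.* (+ 2 ℤ.* d)
  lemma = solve-∀

T₃-superCatalan₃ : ∀ n → T 3 n ≡ superCatalan₃ n ℚ./ 1
T₃-superCatalan₃ n = ½*/ _ (6 ℕ.* n ! ℕ.* (3 ℕ.+ n) !)
  {{ℕ.m*n≢0 (6 ℕ.* n !) ((3 ℕ.+ n) !) {{3 ℕ.!* n !≢0}} {{(3 ℕ.+ n) ℕ.!≢0}}}} (superCatalan₃ n) (begin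
  -- Here 720 = 6! splits as 2 · 6 · 60: the 2 cancels ½, the 6 is the 3! of the denominator, and 60
  -- comes from `superCatalan₃-formula`.
  + (720 ℕ.* (2 ℕ.* n) !)
    ≡⟨ ℤ.pos-* 720 ((2 ℕ.* n) !) ⟩
  + 720 ℤ.* + ((2 ℕ.* n) !)
    ≡⟨ ℤ.*-assoc (+ 12) (+ 60) (+ ((2 ℕ.* n) !)) ⟩
  + 12 ℤ.* (+ 60 ℤ.* + ((2 ℕ.* n) !))
    ≡⟨ cong (+ 12 ℤ.*_) (superCatalan₃-formula n) ⟨
  + 12 ℤ.* (superCatalan₃ n ℤ.* (+ ((3 ℕ.+ n) !) ℤ.* + (n !)))
    ≡⟨ lemma (superCatalan₃ n) (+ ((3 ℕ.+ n) !)) (+ (n !)) ⟩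
  + 2 ℤ.* superCatalan₃ n ℤ.* (+ 6 ℤ.* + (n !) ℤ.* + ((3 ℕ.+ n) !))
    ≡⟨ cong (+ 2 ℤ.* superCatalan₃ n ℤ.*_)
         (trans (ℤ.pos-* (6 ℕ.* n !) ((3 ℕ.+ n) !)) (cong (ℤ._* + ((3 ℕ.+ n) !)) (ℤ.pos-* 6 (n !)))) ⟨
  + 2 ℤ.* superCatalan₃ n ℤ.* + (6 ℕ.* n ! ℕ.* (3 ℕ.+ n) !) ∎)
  where
  open ≡-Reasoning
  lemma : ∀ v a b → + 12 ℤ.* (v ℤ.* (a ℤ.* b)) ≡ + 2 ℤ.* v ℤ.* (+ 6 ℤ.* b ℤ.* a)
  lemma = solve-∀

-- Telescoping

infix 4 _≈[_]_
-- Congruence modulo the power n + 1 of z; it is respected by all polynomial operations and replaces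
-- passing to a limit.
record _≈[_]_ (f : Series) (n : ℕ) (g : Series) : Set where
  constructor coeffwise-≤
  field coeff-≤ : ∀ {k} → k ℕ.≤ n → f k ≡ g k
open _≈[_]_

module _ {n : ℕ} where
  ≈[]-refl : ∀ {f} → f ≈[ n ] f
  ≈[]-refl .coeff-≤ _ = refl

  ≈⇒≈[] : ∀ {f g} → f ≈ g → f ≈[ n ] g
  ≈⇒≈[] f≈g .coeff-≤ {k} _ = coeff f≈g k

  ⊕-cong-≈[] : ∀ {f f′ g g′} → f ≈[ n ] f′ → g ≈[ n ] g′ → f ⊕ g ≈[ n ] f′ ⊕ g′
  ⊕-cong-≈[] f≈ g≈ .coeff-≤ k≤n = cong₂ ℤ._+_ (coeff-≤ f≈ k≤n) (coeff-≤ g≈ k≤n)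

  ⊖-cong-≈[] : ∀ {f f′} → f ≈[ n ] f′ → ⊖ f ≈[ n ] ⊖ f′
  ⊖-cong-≈[] f≈ .coeff-≤ k≤n = cong ℤ.-_ (coeff-≤ f≈ k≤n)

  ⊛-cong-≈[] : ∀ {f f′ g g′} → f ≈[ n ] f′ → g ≈[ n ] g′ → f ⊛ g ≈[ n ] f′ ⊛ g′
  ⊛-cong-≈[] f≈ g≈ .coeff-≤ {k} k≤n = ⊛-cong-≤ k
    (λ j≤k → coeff-≤ f≈ (ℕ.≤-trans j≤k k≤n)) (λ j≤k → coeff-≤ g≈ (ℕ.≤-trans j≤k k≤n))

  ^-cong-≈[] : ∀ {f f′} m → f ≈[ n ] f′ → f ^ m ≈[ n ] f′ ^ m
  ^-cong-≈[] zero    f≈ = ≈[]-refl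
  ^-cong-≈[] (suc m) f≈ = ⊛-cong-≈[] f≈ (^-cong-≈[] m f≈)

  φ-cong-≈[] : ∀ u {f f′} → f ≈[ n ] f′ → φ u f ≈[ n ] φ u f′
  φ-cong-≈[] u {f} {f′} f≈ = ⊕-cong-≈[]
    (⊕-cong-≈[] (⊛f (⊛f (⊛f ≈[]-refl)))
                (⊖-cong-≈[] {const (+ 3) ⊛ u ⊛ u ⊛ f ⊛ f} {const (+ 3) ⊛ u ⊛ u ⊛ f′ ⊛ f′} (⊛f (⊛f ≈[]-refl))))
    (⊛f ≈[]-refl)
    where
    ⊛f : ∀ {g g′} → g ≈[ n ] g′ → g ⊛ f ≈[ n ] g′ ⊛ f′
    ⊛f g≈ = ⊛-cong-≈[] g≈ f≈

  ψ-cong-≈[] : ∀ u {f f′} → f ≈[ n ] f′ → ψ u f ≈[ n ] ψ u f′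
  ψ-cong-≈[] u f≈ = ⊕-cong-≈[] (⊛-cong-≈[] (⊛-cong-≈[] ≈[]-refl f≈) f≈) (⊛-cong-≈[] ≈[]-refl f≈)

-- The contribution of the tuples of least height h to the whole right-hand side of the theorem; the
-- factor 2u inside `summand` carries the coefficient 2 and the index n - 1.
heightTerm : ℕ → Series
heightTerm h = summand z² (dyckBelow h) (dyckBelow (1 ℕ.+ h)) (dyckBelow (2 ℕ.+ h))

potential : ℕ → Series
potential h = φ z² (dyckBelow h) ⊕ ψ z² (dyckBelow (suc h))

dyckBelow-suc′ : ∀ h → dyckBelow (suc h) ≈ const 1ℤ ⊕ z² ⊛ dyckBelow h ⊛ dyckBelow (suc h)
dyckBelow-suc′ h = SR.trans (dyckBelow-suc h)
  (SR.+-congˡ {const 1ℤ} (z²-*-assoc (dyckBelow h) (dyckBelow (suc h))))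

heightTerm-difference : ∀ h → z² ⊛ z² ⊛ heightTerm h ≈ potential (suc h) ⊕ ⊖ potential h
heightTerm-difference h = summand-difference z² (dyckBelow h) (dyckBelow (1 ℕ.+ h)) (dyckBelow (2 ℕ.+ h))
  (dyckBelow-suc′ h) (dyckBelow-suc′ (suc h))

∑-heightTerm : ∀ N → z² ⊛ z² ⊛ ∑ˢ.∑ heightTerm (upTo N) ≈ potential N ⊕ ⊖ potential 0
∑-heightTerm N = SR.trans (∑ˢ.*-∑ (z² ⊛ z²) heightTerm (upTo N))
  (∑ˢ.∑-telescope (λ h → z² ⊛ z² ⊛ heightTerm h) potential heightTerm-difference N)

-- Up to degree n, both series in `potential N` agree with `catalan`, since their height bounds
-- exceed n. In `potential 0` they are the constants 0 and 1.
potential-limit : ∀ {n N} → n ℕ.< N →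
  potential N ⊕ ⊖ potential 0 ≈[ n ] (φ z² catalan ⊕ ψ z² catalan) ⊕ ⊖ (φ z² (const 0ℤ) ⊕ ψ z² (const 1ℤ))
potential-limit {n} {N} n<N = ⊕-cong-≈[]
  {f = potential N} {f′ = φ z² catalan ⊕ ψ z² catalan}
  {g = ⊖ potential 0} {g′ = ⊖ (φ z² (const 0ℤ) ⊕ ψ z² (const 1ℤ))}
  (⊕-cong-≈[] {f = φ z² (dyckBelow N)} {f′ = φ z² catalan}
    (φ-cong-≈[] z² (limit ℕ.≤-refl)) (ψ-cong-≈[] z² (limit (ℕ.n≤1+n N))))
  (⊖-cong-≈[] {f = potential 0} {f′ = φ z² (const 0ℤ) ⊕ ψ z² (const 1ℤ)}
    (⊕-cong-≈[] {f = φ z² (const 0ℤ)} {f′ = φ z² (const 0ℤ)}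
        {g = ψ z² (dyckBelow 1)} {g′ = ψ z² (const 1ℤ)} ≈[]-refl
      (ψ-cong-≈[] z² {dyckBelow 1} {const 1ℤ} (≈⇒≈[] (coeffwise λ { zero → refl ; (suc _) → refl })))))
  where
  limit : ∀ {h} → N ℕ.≤ h → dyckBelow h ≈[ n ] catalan
  limit N≤h .coeff-≤ k≤n = dyckBelow-catalan (ℕ.<-≤-trans (ℕ.≤-<-trans k≤n n<N) N≤h)

-- The correction 7u - 1 - 9u² has degree 4 in z and is gone from z⁶ on. This is where n ≥ 1 enters:
-- for n = 0 the coefficient of z⁴ would be read, which still contains -9.
limit-coeff : ∀ k →
  (catalan ⊕ ⊖ (const (+ 8) ⊛ (z² ⊛ catalan)) ⊕ const (+ 16) ⊛ (z² ⊛ (z² ⊛ catalan))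
    ⊕ (const (+ 7) ⊛ z² ⊕ ⊖ const 1ℤ ⊕ ⊖ (const (+ 9) ⊛ (z² ⊛ z²)))) (6 ℕ.+ k)
  ≡ catalan (6 ℕ.+ k) ℤ.- + 8 ℤ.* catalan (4 ℕ.+ k) ℤ.+ + 16 ℤ.* catalan (2 ℕ.+ k)
limit-coeff k = begin
  catalan (6 ℕ.+ k) ℤ.- (const (+ 8) ⊛ (z² ⊛ catalan)) (6 ℕ.+ k)
      ℤ.+ (const (+ 16) ⊛ (z² ⊛ (z² ⊛ catalan))) (6 ℕ.+ k)
    ℤ.+ ((const (+ 7) ⊛ z²) (6 ℕ.+ k) ℤ.- 0ℤ ℤ.- (const (+ 9) ⊛ (z² ⊛ z²)) (6 ℕ.+ k))
    ≡⟨ cong₂ ℤ._+_ (cong₂ (λ x y → catalan (6 ℕ.+ k) ℤ.- x ℤ.+ y)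
          (trans (const-⊛-coeff (+ 8) (z² ⊛ catalan) (6 ℕ.+ k))
              (cong (+ 8 ℤ.*_) (z²-⊛-coeff catalan (4 ℕ.+ k))))
          (trans (const-⊛-coeff (+ 16) (z² ⊛ (z² ⊛ catalan)) (6 ℕ.+ k)) (cong (+ 16 ℤ.*_)
            (trans (z²-⊛-coeff (z² ⊛ catalan) (4 ℕ.+ k)) (z²-⊛-coeff catalan (2 ℕ.+ k))))))
        (cong₂ (λ x y → x ℤ.- 0ℤ ℤ.- y)
          (const-⊛-coeff (+ 7) z² (6 ℕ.+ k))
          (trans (const-⊛-coeff (+ 9) (z² ⊛ z²) (6 ℕ.+ k)) (cong (+ 9 ℤ.*_) (z²-⊛-coeff z² (4 ℕ.+ k))))) ⟩
  catalan (6 ℕ.+ k) ℤ.- + 8 ℤ.* catalan (4 ℕ.+ k) ℤ.+ + 16 ℤ.* catalan (2 ℕ.+ k) ℤ.+ 0ℤ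
    ≡⟨ ℤ.+-identityʳ _ ⟩
  catalan (6 ℕ.+ k) ℤ.- + 8 ℤ.* catalan (4 ℕ.+ k) ℤ.+ + 16 ℤ.* catalan (2 ℕ.+ k) ∎
  where open ≡-Reasoning

-- The telescoped identity carries a factor z⁴, which moves the index 2n + 2 to 2n + 6; hence the
-- bound on N.
∑-heightTerm-coeff : ∀ n N → 6 ℕ.+ 2 ℕ.* n ℕ.< N →
  ∑ˢ.∑ heightTerm (upTo N) (2 ℕ.* suc n) ≡ superCatalan₃ (suc n)
∑-heightTerm-coeff n N <N = begin
  ∑ˢ.∑ heightTerm (upTo N) (2 ℕ.* suc n)
    ≡⟨ cong (∑ˢ.∑ heightTerm (upTo N)) (ℕ.*-suc 2 n) ⟩
  ∑ˢ.∑ heightTerm (upTo N) (2 ℕ.+ k)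
    ≡⟨ z²-⊛-coeff (∑ˢ.∑ heightTerm (upTo N)) (2 ℕ.+ k) ⟨
  (z² ⊛ ∑ˢ.∑ heightTerm (upTo N)) (4 ℕ.+ k)
    ≡⟨ z²-⊛-coeff (z² ⊛ ∑ˢ.∑ heightTerm (upTo N)) (4 ℕ.+ k) ⟨
  (z² ⊛ (z² ⊛ ∑ˢ.∑ heightTerm (upTo N))) (6 ℕ.+ k)
    ≡⟨ coeff (SR.*-assoc z² z² (∑ˢ.∑ heightTerm (upTo N))) (6 ℕ.+ k) ⟨
  (z² ⊛ z² ⊛ ∑ˢ.∑ heightTerm (upTo N)) (6 ℕ.+ k)
    ≡⟨ coeff (∑-heightTerm N) (6 ℕ.+ k) ⟩
  (potential N ⊕ ⊖ potential 0) (6 ℕ.+ k)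
    ≡⟨ coeff-≤ (potential-limit <N) ℕ.≤-refl ⟩
  ((φ z² catalan ⊕ ψ z² catalan) ⊕ ⊖ (φ z² (const 0ℤ) ⊕ ψ z² (const 1ℤ))) (6 ℕ.+ k)
    ≡⟨ coeff (limit-identity z² catalan catalan-equation′) (6 ℕ.+ k) ⟩
  _
    ≡⟨ limit-coeff k ⟩
  catalan (6 ℕ.+ k) ℤ.- + 8 ℤ.* catalan (4 ℕ.+ k) ℤ.+ + 16 ℤ.* catalan (2 ℕ.+ k)
    ≡⟨ cong (λ l → catalan (4 ℕ.+ l) ℤ.- + 8 ℤ.* catalan (2 ℕ.+ l) ℤ.+ + 16 ℤ.* catalan l) (ℕ.*-suc 2 n) ⟨
  catalan (4 ℕ.+ 2 ℕ.* suc n) ℤ.- + 8 ℤ.* catalan (2 ℕ.+ 2 ℕ.* suc n) ℤ.+ + 16 ℤ.* catalan (2 ℕ.* suc n)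
    ≡⟨ cong₂ (λ x y → catalan x ℤ.- + 8 ℤ.* catalan y ℤ.+ + 16 ℤ.* catalan (2 ℕ.* suc n))
         (trans (cong (2 ℕ.+_) (sym (ℕ.*-suc 2 (suc n)))) (sym (ℕ.*-suc 2 (2 ℕ.+ n))))
         (sym (ℕ.*-suc 2 (suc n))) ⟩
  superCatalan₃ (suc n) ∎
  where
  open ≡-Reasoning
  k = 2 ℕ.* n

-- Counting tuples of Dyck paths

indicator : ∀ {P : Set} → Dec P → ℤ
indicator P? = if does P? then 1ℤ else 0ℤ

indicator-⇔ : ∀ {P Q : Set} (P? : Dec P) (Q? : Dec Q) → P ⇔ Q → indicator P? ≡ indicator Q?
indicator-⇔ P? Q? P⇔Q = cong (if_then 1ℤ else 0ℤ) (does-⇔ P⇔Q P? Q?)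

indicator-× : ∀ {P Q : Set} (P? : Dec P) (Q? : Dec Q) → indicator (P? ×-dec Q?) ≡ indicator P? ℤ.* indicator Q?
indicator-× P? Q? with does P?
... | true  = sym (ℤ.*-identityˡ (indicator Q?))
... | false = refl

-- Dyck paths of bounded height as walks in a strip.

data Walk : ℕ → ℕ → Path → Set where
  []   : ∀ {j} → Walk 0 j []
  up   : ∀ {i j π} → Walk (suc i) j π → Walk i (suc j) (Sign.+ ∷ π)
  down : ∀ {i j π} → Walk i (suc j) π → Walk (suc i) j (Sign.- ∷ π)

walk? : ∀ i j π → Dec (Walk i j π)
walk? zero    j       []           = yes []
walk? (suc i) j       []           = no λ ()
walk? i       zero    (Sign.+ ∷ π) = no λ ()
walk? i       (suc j) (Sign.+ ∷ π) = map′ up (λ { (up w) → w }) (walk? (suc i) j π)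
walk? zero    j       (Sign.- ∷ π) = no λ ()
walk? (suc i) j       (Sign.- ∷ π) = map′ down (λ { (down w) → w }) (walk? i (suc j) π)

walks : ℕ → ℕ → ℕ → ℤ
walks i j l = ∑ᶻ.∑ (λ π → indicator (walk? i j π)) (pathsOfLength l)

walks-suc : ∀ i j l → walks i j (suc l) ≡
  ∑ᶻ.∑ (λ π → indicator (walk? i j (Sign.+ ∷ π))) (pathsOfLength l) ℤ.+
  ∑ᶻ.∑ (λ π → indicator (walk? i j (Sign.- ∷ π))) (pathsOfLength l)
walks-suc i j l = trans
  (∑ᶻ.∑-cartesianProductWith (λ π → indicator (walk? i j π)) _∷_ signs (pathsOfLength l))
  (cong (ℤ._+_ (∑ᶻ.∑ (λ π → indicator (walk? i j (Sign.+ ∷ π))) (pathsOfLength l))) (ℤ.+-identityʳ _))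

-- Both sides split on the first step in the same way; a forbidden step contributes a sum of zeros.
walks-descents : ∀ i j l → walks i j l ≡ descents i j l
walks-descents zero    j       zero    = refl
walks-descents (suc i) j       zero    = refl
walks-descents zero    zero    (suc l) = trans (walks-suc 0 0 l)
  (cong₂ ℤ._+_ (∑ᶻ.∑-zero (pathsOfLength l)) (∑ᶻ.∑-zero (pathsOfLength l)))
walks-descents zero    (suc j) (suc l) = trans (walks-suc 0 (suc j) l)
  (trans (cong₂ ℤ._+_ (walks-descents 1 j l) (∑ᶻ.∑-zero (pathsOfLength l))) (ℤ.+-identityʳ _))
walks-descents (suc i) zero    (suc l) = trans (walks-suc (suc i) 0 l)
  (trans (cong₂ ℤ._+_ (∑ᶻ.∑-zero (pathsOfLength l)) (walks-descents i 1 l)) (ℤ.+-identityˡ _))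
walks-descents (suc i) (suc j) (suc l) = trans (walks-suc (suc i) (suc j) l)
  (cong₂ ℤ._+_ (walks-descents (2 ℕ.+ i) j l) (walks-descents i (2 ℕ.+ j) l))

partialSums-∷ : ∀ s π → partialSums (s ∷ π) ≡ 0ℤ ∷ map (ℤ._+_ (step s)) (partialSums π)
partialSums-∷ s π = cong (0ℤ ∷_) (trans (sym (map-∘ (inits π))) (map-∘ (inits π)))

module _ {P : ℤ → Set} {s : Sign} {π : Path} where
  partialSums-tail : All P (partialSums (s ∷ π)) → All (λ x → P (step s ℤ.+ x)) (partialSums π)
  partialSums-tail ps = All.map⁻ (All.tail (subst (All P) (partialSums-∷ s π) ps))

  partialSums-cons : P 0ℤ → All (λ x → P (step s ℤ.+ x)) (partialSums π) → All P (partialSums (s ∷ π))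
  partialSums-cons p ps = subst (All P) (sym (partialSums-∷ s π)) (p ∷ All.map⁺ ps)

-- Bounds on a partial sum x measured from the starting height i: the floor is i below the start and
-- the ceiling j above it.
Between : ℕ → ℕ → ℤ → Set
Between i j x = 0ℤ ℤ.≤ + i ℤ.+ x × x ℤ.≤ + j

private
  suc-+ : ∀ i x → (1ℤ ℤ.+ i) ℤ.+ x ≡ i ℤ.+ (1ℤ ℤ.+ x)
  suc-+ = solve-∀

  suc-pred : ∀ i x → i ℤ.+ x ≡ (1ℤ ℤ.+ i) ℤ.+ (ℤ.- 1ℤ ℤ.+ x)
  suc-pred = solve-∀

  1+-1+ : ∀ x → 1ℤ ℤ.+ (ℤ.- 1ℤ ℤ.+ x) ≡ x
  1+-1+ = solve-∀

  -1+1+ : ∀ x → ℤ.- 1ℤ ℤ.+ (1ℤ ℤ.+ x) ≡ x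
  -1+1+ = solve-∀

  1+-mono : ∀ {x y} → x ℤ.≤ y → 1ℤ ℤ.+ x ℤ.≤ 1ℤ ℤ.+ y
  1+-mono = ℤ.+-monoʳ-≤ 1ℤ

  1+-cancel : ∀ {x y} → 1ℤ ℤ.+ x ℤ.≤ 1ℤ ℤ.+ y → x ℤ.≤ y
  1+-cancel {x} {y} p = subst₂ ℤ._≤_ (-1+1+ x) (-1+1+ y) (ℤ.+-monoʳ-≤ (ℤ.- 1ℤ) p)

-- This and the next three lemmas move the reference point along the first step: the strip stays
-- fixed while one unit of room changes sides.
between-up : ∀ {i j x} → Between (suc i) j x → Between i (suc j) (1ℤ ℤ.+ x)
between-up {i} {j} {x} (l , u) = subst (0ℤ ℤ.≤_) (suc-+ (+ i) x) l , 1+-mono u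

between-up⁻ : ∀ {i j x} → Between i (suc j) (1ℤ ℤ.+ x) → Between (suc i) j x
between-up⁻ {i} {j} {x} (l , u) = subst (0ℤ ℤ.≤_) (sym (suc-+ (+ i) x)) l , 1+-cancel u

between-down : ∀ {i j x} → Between i (suc j) x → Between (suc i) j (ℤ.- 1ℤ ℤ.+ x)
between-down {i} {j} {x} (l , u) = subst (0ℤ ℤ.≤_) (suc-pred (+ i) x) l ,
  1+-cancel (subst (ℤ._≤ + suc j) (sym (1+-1+ x)) u)

between-down⁻ : ∀ {i j x} → Between (suc i) j (ℤ.- 1ℤ ℤ.+ x) → Between i (suc j) x
between-down⁻ {i} {j} {x} (l , u) = subst (0ℤ ℤ.≤_) (sym (suc-pred (+ i) x)) l ,
  subst (ℤ._≤ + suc j) (1+-1+ x) (1+-mono u)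

between-0 : ∀ i j → Between i j 0ℤ
between-0 i j = ℤ.+≤+ z≤n , ℤ.+≤+ z≤n

walk-between : ∀ {i j π} → Walk i j π → All (Between i j) (partialSums π)
walk-between []       = between-0 _ _ ∷ []
walk-between {π = Sign.+ ∷ π} (up w) =
  partialSums-cons {s = Sign.+} {π = π} (between-0 _ _) (All.map between-up (walk-between w))
walk-between {π = Sign.- ∷ π} (down w) =
  partialSums-cons {s = Sign.-} {π = π} (between-0 _ _) (All.map between-down (walk-between w))

walk-total : ∀ {i j π} → Walk i j π → + i ℤ.+ total π ≡ 0ℤ
walk-total [] = refl
walk-total {i} {π = Sign.+ ∷ π} (up w)   = trans (sym (suc-+ (+ i) (total π))) (walk-total w)
walk-total {suc i} {π = Sign.- ∷ π} (down w) = trans (sym (suc-pred (+ i) (total π))) (walk-total w)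

walk-even : ∀ {i j π} → Walk i j π → 2 ∣ i ℕ.+ length π
walk-even [] = divides 0 refl
walk-even {i} (up w) = subst (2 ∣_) (sym (ℕ.+-suc i _)) (walk-even w)
walk-even {suc i} (down {π = π} w) = subst (2 ∣_) (cong suc (sym (ℕ.+-suc i (length π))))
  (∣m∣n⇒∣m+n ∣-refl (walk-even w))

walk⁺ : ∀ {i j} π → + i ℤ.+ total π ≡ 0ℤ → All (Between i j) (partialSums π) → Walk i j π
walk⁺ {zero}  [] tot≡0 bs = []
walk⁺ {suc i} [] ()    bs
walk⁺ {i} {j} (Sign.+ ∷ π) tot≡0 bs with j | partialSums-tail {s = Sign.+} {π = π} bs
-- A forbidden first step, up at the ceiling or, below, down at the floor, already violates the
-- bound on the first nontrivial partial sum.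
... | zero  | (_ , ℤ.+≤+ ()) ∷ _
... | suc j | bs′ = up (walk⁺ π (trans (suc-+ (+ i) (total π)) tot≡0) (All.map between-up⁻ bs′))
walk⁺ {i} {j} (Sign.- ∷ π) tot≡0 bs with i | partialSums-tail {s = Sign.-} {π = π} bs
... | zero  | (() , _) ∷ _
... | suc i | bs′ = down (walk⁺ π (trans (suc-pred (+ i) (total π)) tot≡0) (All.map between-down⁻ bs′))

foldr-⊔-≤ : ∀ {n} xs → All (ℤ._≤ + n) xs → foldr ℤ._⊔_ 0ℤ xs ℤ.≤ + n
foldr-⊔-≤ []       []       = ℤ.+≤+ z≤n
foldr-⊔-≤ (x ∷ xs) (p ∷ ps) = ℤ.⊔-lub p (foldr-⊔-≤ xs ps)

≤-foldr-⊔ : ∀ {y} xs → foldr ℤ._⊔_ 0ℤ xs ℤ.≤ y → All (ℤ._≤ y) xs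
≤-foldr-⊔ []       p = []
≤-foldr-⊔ (x ∷ xs) p =
  ℤ.≤-trans (ℤ.i≤i⊔j x _) p ∷ ≤-foldr-⊔ xs (ℤ.≤-trans (ℤ.i≤j⊔i x _) p)

0≤foldr-⊔ : ∀ xs → 0ℤ ℤ.≤ foldr ℤ._⊔_ 0ℤ xs
0≤foldr-⊔ []       = ℤ.≤-refl
0≤foldr-⊔ (x ∷ xs) = ℤ.≤-trans (0≤foldr-⊔ xs) (ℤ.i≤j⊔i x _)

-- The fold in `height` starts at 0, so the absolute value loses nothing.
heightℕ : Path → ℕ
heightℕ π = ∣ height π ∣

height≡ : ∀ π → + heightℕ π ≡ height π
height≡ π = ℤ.0≤i⇒+∣i∣≡i (0≤foldr-⊔ (partialSums π))

partialSums≤length : ∀ π → All (ℤ._≤ + length π) (partialSums π)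
partialSums≤length []           = ℤ.≤-refl ∷ []
partialSums≤length (Sign.+ ∷ π) = partialSums-cons {s = Sign.+} {π = π} (ℤ.+≤+ z≤n)
  (All.map 1+-mono (partialSums≤length π))
partialSums≤length (Sign.- ∷ π) = partialSums-cons {s = Sign.-} {π = π} (ℤ.+≤+ z≤n)
  (All.map (λ {x} x≤ → 1+-cancel (subst (ℤ._≤ + (2 ℕ.+ length π)) (sym (1+-1+ x))
      (ℤ.≤-trans x≤ (ℤ.+≤+ (ℕ.m≤n+m (length π) 2)))))
           (partialSums≤length π))

-- This bounds the heights in a tuple by its total length, so that finite sums over h suffice.
heightℕ≤length : ∀ π → heightℕ π ℕ.≤ length π
heightℕ≤length π = ℤ.drop‿+≤+ (subst (ℤ._≤ + length π) (sym (height≡ π))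
  (foldr-⊔-≤ (partialSums π) (partialSums≤length π)))

-- The strict bound by `suc h` against the ceiling h is the offset in `dyckBelow (suc h)` =
-- `descents 0 h`. Evenness of the length is supplied by `walk-even`.
walk⇔dyck : ∀ h π → (IsDyck π × heightℕ π ℕ.< suc h) ⇔ Walk 0 h π
walk⇔dyck h π = mk⇔ to from
  where
  to : IsDyck π × heightℕ π ℕ.< suc h → Walk 0 h π
  to ((_ , tot≡0 , 0≤) , s≤s ht≤h) = walk⁺ π (trans (ℤ.+-identityˡ _) tot≡0)
    (All.zip (All.map (λ {x} → subst (0ℤ ℤ.≤_) (sym (ℤ.+-identityˡ x))) 0≤ ,
              ≤-foldr-⊔ (partialSums π) (subst (ℤ._≤ + h) (height≡ π) (ℤ.+≤+ ht≤h))))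
  from : Walk 0 h π → IsDyck π × heightℕ π ℕ.< suc h
  from w = (walk-even w , trans (sym (ℤ.+-identityˡ _)) (walk-total w)
           , All.map (λ { {x} (0≤ , _) → subst (0ℤ ℤ.≤_) (ℤ.+-identityˡ x) 0≤ }) (walk-between w))
         , s≤s (ℤ.drop‿+≤+ (subst (ℤ._≤ + h) (sym (height≡ π))
             (foldr-⊔-≤ (partialSums π) (All.map proj₂ (walk-between w)))))

dyck : Path → ℤ
dyck π = indicator (isDyck? π)

below : ℕ → ℕ → ℤ
below t h = indicator (t ℕ.<? h)

dyck-below-sum : ∀ h l → ∑ᶻ.∑ (λ π → dyck π ℤ.* below (heightℕ π) h) (pathsOfLength l) ≡ dyckBelow h l
dyck-below-sum zero l = trans (trans (∑ᶻ.∑-cong (pathsOfLength l) (λ π → ℤ.*-zeroʳ (dyck π)))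
  (∑ᶻ.∑-zero (pathsOfLength l))) (const-0 l)
  where
  const-0 : ∀ l → 0ℤ ≡ const 0ℤ l
  const-0 zero    = refl
  const-0 (suc l) = refl
dyck-below-sum (suc h) l = trans
  (∑ᶻ.∑-cong (pathsOfLength l) λ π → trans
    (sym (indicator-× (isDyck? π) (heightℕ π ℕ.<? suc h)))
    (indicator-⇔ (isDyck? π ×-dec (heightℕ π ℕ.<? suc h)) (walk? 0 h π) (walk⇔dyck h π)))
  (walks-descents 0 h l)

-- Products over tuples and powers of generating functions.

private variable
  A B : Set
  m : ℕ

∏ : (A → ℤ) → Vec A m → ℤ
∏ f []       = 1ℤ
∏ f (x ∷ xs) = f x ℤ.* ∏ f xs

∏-cong : ∀ {f g : A → ℤ} → (∀ x → f x ≡ g x) → (xs : Vec A m) → ∏ f xs ≡ ∏ g xs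
∏-cong f≡g []       = refl
∏-cong f≡g (x ∷ xs) = cong₂ ℤ._*_ (f≡g x) (∏-cong f≡g xs)

∏-* : ∀ (f g : A → ℤ) (xs : Vec A m) → ∏ (λ x → f x ℤ.* g x) xs ≡ ∏ f xs ℤ.* ∏ g xs
∏-* f g []       = refl
∏-* f g (x ∷ xs) = trans (cong (ℤ._*_ (f x ℤ.* g x)) (∏-* f g xs)) (lemma (f x) (g x) (∏ f xs) (∏ g xs))
  where
  lemma : ∀ a b c d → a ℤ.* b ℤ.* (c ℤ.* d) ≡ a ℤ.* c ℤ.* (b ℤ.* d)
  lemma = solve-∀

∏-map : ∀ (f : B → ℤ) (g : A → B) (xs : Vec A m) → ∏ f (Vec.map g xs) ≡ ∏ (f ∘ g) xs
∏-map f g []       = refl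
∏-map f g (x ∷ xs) = cong (ℤ._*_ (f (g x))) (∏-map f g xs)

∏-zero : ∀ (f : A → ℤ) (xs : Vec A m) i → f (lookup xs i) ≡ 0ℤ → ∏ f xs ≡ 0ℤ
∏-zero f (x ∷ xs) zero    fx≡0 = cong (ℤ._* ∏ f xs) fx≡0
∏-zero f (x ∷ xs) (suc i) fx≡0 = trans (cong (ℤ._*_ (f x)) (∏-zero f xs i fx≡0)) (ℤ.*-zeroʳ (f x))

∏-indicator : ∀ {P : A → Set} (P? : Decidable P) (xs : Vec A m) →
  ∏ (λ x → indicator (P? x)) xs ≡ indicator (VecAll.all? P? xs)
∏-indicator P? []       = refl
∏-indicator P? (x ∷ xs) = trans (cong (ℤ._*_ (indicator (P? x))) (∏-indicator P? xs))
  (sym (indicator-× (P? x) (VecAll.all? P? xs)))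

weigh : (Path → ℤ) → Path → Series
weigh f π = const (f π) ⊛ monomial (length π)

weighTuple : (Path → ℤ) → Vec Path m → Series
weighTuple f πs = const (∏ f πs) ⊛ monomial (totalLength πs)

weighTuple-∷ : ∀ f π (πs : Vec Path m) → weigh f π ⊛ weighTuple f πs ≈ weighTuple f (π ∷ πs)
weighTuple-∷ f π πs = SR.trans
  (interchange (const (f π)) (monomial (length π)) (const (∏ f πs)) (monomial (totalLength πs)))
  (SR.sym (SR.*-cong (_-Raw-AlmostCommutative⟶_.*-homo const-homomorphism (f π) (∏ f πs))
                     (monomial-+ (length π) (totalLength πs))))

-- Expand the power by distributivity: choosing a path in each of the m factors is choosing a tuple,
-- and the weights multiply.
∑-weigh-^ : ∀ f m ps → ∑ˢ.∑ (weigh f) ps ^ m ≈ ∑ˢ.∑ (weighTuple f) (tuples m ps)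
∑-weigh-^ f zero    ps = SR.sym (SR.trans (SR.+-identityʳ (weighTuple f [])) (SR.*-identityˡ (const 1ℤ)))
∑-weigh-^ f (suc m) ps = begin
  ∑ˢ.∑ (weigh f) ps ⊛ ∑ˢ.∑ (weigh f) ps ^ m
    ≈⟨ SR.*-congˡ (∑-weigh-^ f m ps) ⟩
  ∑ˢ.∑ (weigh f) ps ⊛ ∑ˢ.∑ (weighTuple f) (tuples m ps)
    ≈⟨ ∑ˢ.∑-* (weigh f) ps _ ⟩
  ∑ˢ.∑ (λ π → weigh f π ⊛ ∑ˢ.∑ (weighTuple f) (tuples m ps)) ps
    ≈⟨ ∑ˢ.∑-cong ps (λ π → SR.trans (∑ˢ.*-∑ (weigh f π) (weighTuple f) (tuples m ps))
                                    (∑ˢ.∑-cong (tuples m ps) (weighTuple-∷ f π))) ⟩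
  ∑ˢ.∑ (λ π → ∑ˢ.∑ (λ πs → weighTuple f (π ∷ πs)) (tuples m ps)) ps
    ≈⟨ ∑ˢ.∑-cartesianProductWith (weighTuple f) _∷_ ps (tuples m ps) ⟨
  ∑ˢ.∑ (weighTuple f) (tuples (suc m) ps) ∎
  where open import Relation.Binary.Reasoning.Setoid SR.setoid

∑-coeff : ∀ (F : A → Series) xs k → ∑ˢ.∑ F xs k ≡ ∑ᶻ.∑ (λ x → F x k) xs
∑-coeff F []       zero    = refl
∑-coeff F []       (suc k) = refl
∑-coeff F (x ∷ xs) k       = cong (ℤ._+_ (F x k)) (∑-coeff F xs k)

generate : (Path → ℤ) → Series
generate f k = ∑ᶻ.∑ f (pathsOfLength k)

∑-monomial-coeff : ∀ (f : ℕ → ℤ) k n → k ℕ.< n → ∑ᶻ.∑ (λ l → f l ℤ.* monomial l k) (upTo n) ≡ f k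
∑-monomial-coeff f zero (suc n) _ = begin
  ∑ᶻ.∑ (λ l → f l ℤ.* monomial l 0) (upTo (suc n))
    ≡⟨ ∑ᶻ.∑-upTo-suc (λ l → f l ℤ.* monomial l 0) n ⟩
  f 0 ℤ.* 1ℤ ℤ.+ ∑ᶻ.∑ (λ l → f (suc l) ℤ.* 0ℤ) (upTo n)
    ≡⟨ cong₂ ℤ._+_ (ℤ.*-identityʳ (f 0))
         (trans (∑ᶻ.∑-cong (upTo n) (λ l → ℤ.*-zeroʳ (f (suc l)))) (∑ᶻ.∑-zero (upTo n))) ⟩
  f 0 ℤ.+ 0ℤ
    ≡⟨ ℤ.+-identityʳ (f 0) ⟩
  f 0 ∎
  where open ≡-Reasoning
∑-monomial-coeff f (suc k) (suc n) (s≤s k<n) = begin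
  ∑ᶻ.∑ (λ l → f l ℤ.* monomial l (suc k)) (upTo (suc n))
    ≡⟨ ∑ᶻ.∑-upTo-suc (λ l → f l ℤ.* monomial l (suc k)) n ⟩
  f 0 ℤ.* 0ℤ ℤ.+ ∑ᶻ.∑ (λ l → f (suc l) ℤ.* monomial l k) (upTo n)
    ≡⟨ cong₂ ℤ._+_ (ℤ.*-zeroʳ (f 0)) (∑-monomial-coeff (f ∘ suc) k n k<n) ⟩
  0ℤ ℤ.+ f (suc k)
    ≡⟨ ℤ.+-identityˡ _ ⟩
  f (suc k) ∎
  where open ≡-Reasoning

-- The agreement stops at degree n because the list omits longer paths. For the coefficient of index
-- n of a power this is enough.
∑-weigh : ∀ f n → ∑ˢ.∑ (weigh f) (pathsUpTo n) ≈[ n ] generate f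
∑-weigh f n .coeff-≤ {k} k≤n = begin
  ∑ˢ.∑ (weigh f) (pathsUpTo n) k
    ≡⟨ ∑-coeff (weigh f) (pathsUpTo n) k ⟩
  ∑ᶻ.∑ (λ π → weigh f π k) (pathsUpTo n)
    ≡⟨ ∑ᶻ.∑-concatMap (λ π → weigh f π k) pathsOfLength (upTo (suc n)) ⟩
  ∑ᶻ.∑ (λ l → ∑ᶻ.∑ (λ π → weigh f π k) (pathsOfLength l)) (upTo (suc n))
    ≡⟨ ∑ᶻ.∑-cong (upTo (suc n)) (λ l → trans
         (∑ᶻ.∑-cong-∈ (pathsOfLength l) (λ {π} π∈ → trans (const-⊛-coeff (f π) (monomial (length π)) k)
            (cong (λ l → f π ℤ.* monomial l k) (∈-pathsOfLength⁻ l π∈))))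
         (sym (∑ᶻ.∑-* f (pathsOfLength l) (monomial l k)))) ⟩
  ∑ᶻ.∑ (λ l → generate f l ℤ.* monomial l k) (upTo (suc n))
    ≡⟨ ∑-monomial-coeff (generate f) k (suc n) (s≤s k≤n) ⟩
  generate f k ∎
  where open ≡-Reasoning

∑-tuples-coeff : ∀ f m n →
  ∑ᶻ.∑ (λ πs → ∏ f πs ℤ.* monomial (totalLength πs) n) (tuples m (pathsUpTo n)) ≡ (generate f ^ m) n
∑-tuples-coeff f m n = begin
  ∑ᶻ.∑ (λ πs → ∏ f πs ℤ.* monomial (totalLength πs) n) (tuples m (pathsUpTo n))
    ≡⟨ ∑ᶻ.∑-cong (tuples m (pathsUpTo n)) (λ πs → const-⊛-coeff (∏ f πs) (monomial (totalLength πs)) n) ⟨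
  ∑ᶻ.∑ (λ πs → weighTuple f πs n) (tuples m (pathsUpTo n))
    ≡⟨ ∑-coeff (weighTuple f) (tuples m (pathsUpTo n)) n ⟨
  ∑ˢ.∑ (weighTuple f) (tuples m (pathsUpTo n)) n
    ≡⟨ coeff (∑-weigh-^ f m (pathsUpTo n)) n ⟨
  (∑ˢ.∑ (weigh f) (pathsUpTo n) ^ m) n
    ≡⟨ coeff-≤ (^-cong-≈[] m (∑-weigh f n)) ℕ.≤-refl ⟩
  (generate f ^ m) n ∎
  where open ≡-Reasoning

-- Tuples of numbers that differ by at most k.

Close : ℕ → Vec ℕ m → Set
Close k ts = ∀ i j → ∣ + lookup ts i ℤ.- + lookup ts j ∣ ℕ.≤ k

close? : ∀ k (ts : Vec ℕ m) → Dec (Close k ts)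
close? k ts = Fin.all? (λ i → Fin.all? (λ j → ∣ + lookup ts i ℤ.- + lookup ts j ∣ ℕ.≤? k))

-- between h l t is 1 if h ≤ t < l, for h ≤ l.
between : ℕ → ℕ → ℕ → ℤ
between h l t = below t l ℤ.- below t h

-- All entries lie in [h, h + k], minus the case that all lie in [h + 1, h + k]: what remains says
-- that the minimum is h and the maximum at most h + k.
closeTerm : ℕ → Vec ℕ m → ℕ → ℤ
closeTerm k ts h = ∏ (between h (suc (h ℕ.+ k))) ts ℤ.- ∏ (between (suc h) (suc (h ℕ.+ k))) ts

∣-∣-suc : ∀ a b → ∣ + suc a ℤ.- + suc b ∣ ≡ ∣ + a ℤ.- + b ∣
∣-∣-suc a b = cong ∣_∣ (trans (ℤ.m-n≡m⊖n (suc a) (suc b)) (trans (ℤ.[1+m]⊖[1+n]≡m⊖n a b) (sym (ℤ.m-n≡m⊖n a b))))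

close-map-suc : ∀ k (ts : Vec ℕ m) → Close k ts ⇔ Close k (Vec.map suc ts)
close-map-suc k ts = mk⇔ (λ c i j → subst (ℕ._≤ k) (sym (eq i j)) (c i j))
  (λ c i j → subst (ℕ._≤ k) (eq i j) (c i j))
  where
  eq : ∀ i j → ∣ + lookup (Vec.map suc ts) i ℤ.- + lookup (Vec.map suc ts) j ∣
      ≡ ∣ + lookup ts i ℤ.- + lookup ts j ∣
  eq i j = trans (cong₂ (λ a b → ∣ + a ℤ.- + b ∣) (Vec.lookup-map i suc ts) (Vec.lookup-map j suc ts))
    (∣-∣-suc (lookup ts i) (lookup ts j))

-- A difference of natural numbers is at most their maximum; conversely, compare every entry with
-- the zero entry.
close-zero : ∀ k (ts : Vec ℕ m) i → lookup ts i ≡ 0 → VecAll.All (ℕ._≤ k) ts ⇔ Close k ts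
close-zero k ts i tᵢ≡0 = mk⇔ to from
  where
  to : VecAll.All (ℕ._≤ k) ts → Close k ts
  to ≤k a b = ℕ.≤-trans
    (subst (λ x → ∣ x ∣ ℕ.≤ lookup ts a ℕ.⊔ lookup ts b) (sym (ℤ.m-n≡m⊖n (lookup ts a) (lookup ts b)))
      (ℤ.∣m⊝n∣≤m⊔n (lookup ts a) (lookup ts b)))
    (ℕ.⊔-lub (VecAll.lookup⁺ ≤k a) (VecAll.lookup⁺ ≤k b))
  from : Close k ts → VecAll.All (ℕ._≤ k) ts
  from c = VecAll.lookup⁻ (λ a → subst (ℕ._≤ k)
    (trans (cong (λ t → ∣ + lookup ts a ℤ.- + t ∣) tᵢ≡0) (cong ∣_∣ (ℤ.+-identityʳ (+ lookup ts a)))) (c a i))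

unmap-suc : (ts : Vec ℕ m) → (∀ i → lookup ts i ≢ 0) → ∃ λ ts′ → ts ≡ Vec.map suc ts′
unmap-suc []           ≢0 = [] , refl
unmap-suc (zero  ∷ ts) ≢0 = contradiction refl (≢0 zero)
unmap-suc (suc t ∷ ts) ≢0 with ts′ , refl ← unmap-suc ts (≢0 ∘ suc) = t ∷ ts′ , refl

-- Only the term at h = min ts survives.
∑-closeTerm : ∀ k N (ts : Vec ℕ (suc m)) → VecAll.All (ℕ._< N) ts →
  ∑ᶻ.∑ (closeTerm k ts) (upTo N) ≡ indicator (close? k ts)
-- The tuple must be nonempty: for the empty one every term is 1 - 1 = 0, whereas it is trivially
-- close.
∑-closeTerm k zero    (t ∷ ts) (() ∷ _)
-- If 0 occurs, the minimum is 0 and only h = 0 contributes. Otherwise lower every entry by one,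
-- which shifts the summation index by one.
∑-closeTerm k (suc N) ts ts<N with Fin.any? (λ i → lookup ts i ℕ.≟ 0)
... | yes (i , tᵢ≡0) = begin
  ∑ᶻ.∑ (closeTerm k ts) (upTo (suc N))
    ≡⟨ ∑ᶻ.∑-upTo-suc (closeTerm k ts) N ⟩
  closeTerm k ts 0 ℤ.+ ∑ᶻ.∑ (closeTerm k ts ∘ suc) (upTo N)
    ≡⟨ cong₂ ℤ._+_ (cong₂ ℤ._-_ first (vanish 0 k))
         (trans (∑ᶻ.∑-cong (upTo N) (λ h → cong₂ ℤ._-_ (vanish h (suc (h ℕ.+ k))) (vanish (suc h) (suc (h ℕ.+ k)))))
             (∑ᶻ.∑-zero (upTo N))) ⟩
  indicator (close? k ts) ℤ.- 0ℤ ℤ.+ 0ℤ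
    ≡⟨ trans (ℤ.+-identityʳ _) (ℤ.+-identityʳ _) ⟩
  indicator (close? k ts) ∎
  where
  open ≡-Reasoning
  vanish : ∀ h l → ∏ (between (suc h) (suc l)) ts ≡ 0ℤ
  vanish h l = ∏-zero (between (suc h) (suc l)) ts i (cong (between (suc h) (suc l)) tᵢ≡0)
  first : ∏ (between 0 (suc k)) ts ≡ indicator (close? k ts)
  first = begin
    ∏ (between 0 (suc k)) ts
      ≡⟨ ∏-cong (λ t → trans (ℤ.+-identityʳ (below t (suc k)))
            (indicator-⇔ (t ℕ.<? suc k) (t ℕ.≤? k) (mk⇔ ℕ.s≤s⁻¹ s≤s))) ts ⟩
    ∏ (λ t → indicator (t ℕ.≤? k)) ts
      ≡⟨ ∏-indicator (ℕ._≤? k) ts ⟩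
    indicator (VecAll.all? (ℕ._≤? k) ts)
      ≡⟨ indicator-⇔ (VecAll.all? (ℕ._≤? k) ts) (close? k ts) (close-zero k ts i tᵢ≡0) ⟩
    indicator (close? k ts) ∎
... | no ∄0 with ts′ , refl ← unmap-suc ts (λ i tᵢ≡0 → ∄0 (i , tᵢ≡0)) = begin
  ∑ᶻ.∑ (closeTerm k ts) (upTo (suc N))
    ≡⟨ ∑ᶻ.∑-upTo-suc (closeTerm k ts) N ⟩
  closeTerm k ts 0 ℤ.+ ∑ᶻ.∑ (closeTerm k ts ∘ suc) (upTo N)
    ≡⟨ cong₂ ℤ._+_ first (∑ᶻ.∑-cong (upTo N) rest) ⟩
  0ℤ ℤ.+ ∑ᶻ.∑ (closeTerm k ts′) (upTo N)
    ≡⟨ ℤ.+-identityˡ _ ⟩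
  ∑ᶻ.∑ (closeTerm k ts′) (upTo N)
    ≡⟨ ∑-closeTerm k N ts′ (VecAll.map ℕ.s≤s⁻¹ (VecAll.map⁻ ts<N)) ⟩
  indicator (close? k ts′)
    ≡⟨ indicator-⇔ (close? k ts′) (close? k ts) (close-map-suc k ts′) ⟩
  indicator (close? k ts) ∎
  where
  open ≡-Reasoning
  first : closeTerm k ts 0 ≡ 0ℤ
  -- For positive entries the lower bounds 0 and 1 say the same, so the two products cancel.
  first = trans
    (cong₂ ℤ._-_ (∏-map (between 0 (suc k)) suc ts′) (∏-map (between 1 (suc k)) suc ts′))
    (ℤ.+-inverseʳ (∏ (between 0 (suc k) ∘ suc) ts′))
  rest : ∀ h → closeTerm k ts (suc h) ≡ closeTerm k ts′ h
  rest h = cong₂ ℤ._-_ (∏-map (between (suc h) (suc (suc h ℕ.+ k))) suc ts′)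
                       (∏-map (between (2 ℕ.+ h) (suc (suc h ℕ.+ k))) suc ts′)

-- The generating function of `G`.

length-filter : ∀ {A : Set} {P : A → Set} (P? : Decidable P) xs →
  + length (filter P? xs) ≡ ∑ᶻ.∑ (λ x → indicator (P? x)) xs
length-filter P? []       = refl
length-filter P? (x ∷ xs) with does (P? x)
... | true  = cong (ℤ._+_ 1ℤ) (length-filter P? xs)
... | false = trans (length-filter P? xs) (sym (ℤ.+-identityˡ _))

monomial-indicator : ∀ l k → monomial l k ≡ indicator (l ℕ.≟ k)
monomial-indicator zero    zero    = refl
monomial-indicator zero    (suc k) = refl
monomial-indicator (suc l) zero    = refl
monomial-indicator (suc l) (suc k) = monomial-indicator l k

band : ℕ → ℕ → Path → ℤ
band h l π = dyck π ℤ.* between h l (heightℕ π)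

bandTerm : ∀ {m} → ℕ → Vec Path m → ℕ → ℤ
bandTerm k πs h = ∏ (band h (suc (h ℕ.+ k))) πs ℤ.- ∏ (band (suc h) (suc (h ℕ.+ k))) πs

∏-band : ∀ {m} h l (πs : Vec Path m) →
  ∏ (band h l) πs ≡ indicator (VecAll.all? isDyck? πs) ℤ.* ∏ (between h l) (Vec.map heightℕ πs)
∏-band h l πs = trans (∏-* dyck (between h l ∘ heightℕ) πs)
  (cong₂ ℤ._*_ (∏-indicator isDyck? πs) (sym (∏-map (between h l) heightℕ πs)))

heights≤ : ∀ {m} (πs : Vec Path m) → VecAll.All (ℕ._≤ totalLength πs) (Vec.map heightℕ πs)
heights≤ []       = []
heights≤ (π ∷ πs) = ℕ.≤-trans (heightℕ≤length π) (ℕ.m≤m+n _ _)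
                  ∷ VecAll.map (λ t≤ → ℕ.≤-trans t≤ (ℕ.m≤n+m _ (length π))) (heights≤ πs)

∑-bandTerm : ∀ {m} k N (πs : Vec Path (suc m)) → totalLength πs ℕ.< N →
  ∑ᶻ.∑ (bandTerm k πs) (upTo N)
    ≡ indicator (VecAll.all? isDyck? πs) ℤ.* indicator (close? k (Vec.map heightℕ πs))
∑-bandTerm k N πs <N = begin
  ∑ᶻ.∑ (bandTerm k πs) (upTo N)
    ≡⟨ ∑ᶻ.∑-cong (upTo N) (λ h → trans
         (cong₂ ℤ._-_ (∏-band h (suc (h ℕ.+ k)) πs) (∏-band (suc h) (suc (h ℕ.+ k)) πs))
         (lemma all-dyck (∏ (between h (suc (h ℕ.+ k))) ts) (∏ (between (suc h) (suc (h ℕ.+ k))) ts))) ⟩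
  ∑ᶻ.∑ (λ h → all-dyck ℤ.* closeTerm k ts h) (upTo N)
    ≡⟨ ∑ᶻ.*-∑ all-dyck (closeTerm k ts) (upTo N) ⟨
  all-dyck ℤ.* ∑ᶻ.∑ (closeTerm k ts) (upTo N)
    ≡⟨ cong (ℤ._*_ all-dyck) (∑-closeTerm k N ts (VecAll.map (λ t≤ → ℕ.≤-<-trans t≤ <N) (heights≤ πs))) ⟩
  all-dyck ℤ.* indicator (close? k ts) ∎
  where
  open ≡-Reasoning
  ts = Vec.map heightℕ πs
  all-dyck = indicator (VecAll.all? isDyck? πs)
  lemma : ∀ a x y → a ℤ.* x ℤ.- a ℤ.* y ≡ a ℤ.* (x ℤ.- y)
  lemma = solve-∀

heights-close? : ∀ {m} k (πs : Vec Path m) →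
  Dec (∀ i j → ∣ height (lookup πs i) ℤ.- height (lookup πs j) ∣ ℕ.≤ k)
heights-close? k πs = Fin.all? (λ i → Fin.all? (λ j → ∣ height (lookup πs i) ℤ.- height (lookup πs j) ∣ ℕ.≤? k))

close⇔heights-close : ∀ {m} k (πs : Vec Path m) →
  Close k (Vec.map heightℕ πs) ⇔ (∀ i j → ∣ height (lookup πs i) ℤ.- height (lookup πs j) ∣ ℕ.≤ k)
close⇔heights-close k πs = mk⇔
  (λ c i j → subst (λ x → ∣ x ∣ ℕ.≤ k) (cong₂ ℤ._-_ (eq i) (eq j)) (c i j))
  (λ c i j → subst (λ x → ∣ x ∣ ℕ.≤ k) (sym (cong₂ ℤ._-_ (eq i) (eq j))) (c i j))
  where
  eq : ∀ i → + lookup (Vec.map heightℕ πs) i ≡ height (lookup πs i)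
  eq i = trans (cong +_ (Vec.lookup-map i heightℕ πs)) (height≡ (lookup πs i))

admissible-indicator : ∀ {m} n k N (πs : Vec Path (suc m)) → 2 ℕ.* n ℕ.< N →
  indicator (admissible? (+ n) k πs) ≡ ∑ᶻ.∑ (bandTerm k πs) (upTo N) ℤ.* monomial (totalLength πs) (2 ℕ.* n)
admissible-indicator n k N πs 2n<N = begin
  indicator (admissible? (+ n) k πs)
    ≡⟨ indicator-× (VecAll.all? isDyck? πs) ((+ totalLength πs ℤ.≟ + 2 ℤ.* + n) ×-dec heights-close? k πs) ⟩
  all-dyck ℤ.* indicator ((+ totalLength πs ℤ.≟ + 2 ℤ.* + n) ×-dec heights-close? k πs)
    ≡⟨ cong (ℤ._*_ all-dyck) (indicator-× (+ totalLength πs ℤ.≟ + 2 ℤ.* + n) (heights-close? k πs)) ⟩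
  all-dyck ℤ.* (indicator (+ totalLength πs ℤ.≟ + 2 ℤ.* + n) ℤ.* indicator (heights-close? k πs))
    ≡⟨ cong₂ (λ x y → all-dyck ℤ.* (x ℤ.* y))
         (indicator-⇔ (+ totalLength πs ℤ.≟ + 2 ℤ.* + n) (totalLength πs ℕ.≟ 2 ℕ.* n)
            (mk⇔ (λ eq → ℤ.+-injective (trans eq (sym (ℤ.pos-* 2 n))))
                (λ eq → trans (cong +_ eq) (ℤ.pos-* 2 n))))
         (sym (indicator-⇔ (close? k (Vec.map heightℕ πs)) (heights-close? k πs) (close⇔heights-close k πs))) ⟩
  all-dyck ℤ.* (indicator (totalLength πs ℕ.≟ 2 ℕ.* n) ℤ.* closeness)
    ≡⟨ cases (totalLength πs ℕ.≟ 2 ℕ.* n) ⟩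
  ∑ᶻ.∑ (bandTerm k πs) (upTo N) ℤ.* indicator (totalLength πs ℕ.≟ 2 ℕ.* n)
    ≡⟨ cong (ℤ._*_ (∑ᶻ.∑ (bandTerm k πs) (upTo N))) (monomial-indicator (totalLength πs) (2 ℕ.* n)) ⟨
  ∑ᶻ.∑ (bandTerm k πs) (upTo N) ℤ.* monomial (totalLength πs) (2 ℕ.* n) ∎
  where
  open ≡-Reasoning
  all-dyck = indicator (VecAll.all? isDyck? πs)
  closeness = indicator (close? k (Vec.map heightℕ πs))
  -- `∑-bandTerm` requires N to exceed the total length, which is known only if that length is 2n;
  -- otherwise both sides carry a factor 0.
  cases : (eq? : Dec (totalLength πs ≡ 2 ℕ.* n)) →
    all-dyck ℤ.* (indicator eq? ℤ.* closeness) ≡ ∑ᶻ.∑ (bandTerm k πs) (upTo N) ℤ.* indicator eq?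
  cases (yes eq) = trans (cong (ℤ._*_ all-dyck) (ℤ.*-identityˡ closeness))
    (trans (sym (∑-bandTerm k N πs (subst (ℕ._< N) (sym eq) 2n<N))) (sym (ℤ.*-identityʳ _)))
  cases (no _)   = trans (ℤ.*-zeroʳ all-dyck) (sym (ℤ.*-zeroʳ (∑ᶻ.∑ (bandTerm k πs) (upTo N))))

gfTerm : ℕ → ℕ → ℕ → Series
gfTerm m k h = (dyckBelow (suc (h ℕ.+ k)) ⊕ ⊖ dyckBelow h) ^ m
  ⊕ ⊖ ((dyckBelow (suc (h ℕ.+ k)) ⊕ ⊖ dyckBelow (suc h)) ^ m)

generate-band : ∀ h l → generate (band h l) ≈ dyckBelow l ⊕ ⊖ dyckBelow h
generate-band h l .coeff n = begin
  ∑ᶻ.∑ (band h l) (pathsOfLength n)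
    ≡⟨ ∑ᶻ.∑-cong (pathsOfLength n) (λ π → lemma (dyck π) (below (heightℕ π) l) (below (heightℕ π) h)) ⟩
  ∑ᶻ.∑ (λ π → dyck π ℤ.* below (heightℕ π) l ℤ.- dyck π ℤ.* below (heightℕ π) h) (pathsOfLength n)
    ≡⟨ ∑ᶻ.∑-sub (λ π → dyck π ℤ.* below (heightℕ π) l)
       (λ π → dyck π ℤ.* below (heightℕ π) h) (pathsOfLength n) ⟩
  ∑ᶻ.∑ (λ π → dyck π ℤ.* below (heightℕ π) l) (pathsOfLength n)
    ℤ.- ∑ᶻ.∑ (λ π → dyck π ℤ.* below (heightℕ π) h) (pathsOfLength n)
    ≡⟨ cong₂ ℤ._-_ (dyck-below-sum l n) (dyck-below-sum h n) ⟩
  dyckBelow l n ℤ.- dyckBelow h n ∎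
  where
  open ≡-Reasoning
  lemma : ∀ a x y → a ℤ.* (x ℤ.- y) ≡ a ℤ.* x ℤ.- a ℤ.* y
  lemma = solve-∀

∑-∏-band-coeff : ∀ h l m n →
  ∑ᶻ.∑ (λ πs → ∏ (band h l) πs ℤ.* monomial (totalLength πs) n) (tuples m (pathsUpTo n))
    ≡ ((dyckBelow l ⊕ ⊖ dyckBelow h) ^ m) n
∑-∏-band-coeff h l m n = trans (∑-tuples-coeff (band h l) m n)
  (coeff (^-cong {generate (band h l)} (generate-band h l) (refl {x = m})) n)

-- Sort the tuples by least height and exchange the two sums; for fixed h, each product over a tuple
-- sums to a coefficient of a power. No height exceeds the total length 2n, so any N above it
-- captures all tuples.
G-gf : ∀ n m k N → 2 ℕ.* n ℕ.< N → + G (+ n) (suc m) k ≡ ∑ˢ.∑ (gfTerm (suc m) k) (upTo N) (2 ℕ.* n)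
G-gf n m k N 2n<N = begin
  + G (+ n) (suc m) k
    ≡⟨ length-filter (admissible? (+ n) k) (tuples (suc m) (pathsUpTo ∣ + 2 ℤ.* + n ∣)) ⟩
  ∑ᶻ.∑ (λ πs → indicator (admissible? (+ n) k πs)) (tuples (suc m) (pathsUpTo ∣ + 2 ℤ.* + n ∣))
    ≡⟨ cong (λ l → ∑ᶻ.∑ (λ πs → indicator (admissible? (+ n) k πs)) (tuples (suc m) (pathsUpTo ∣ l ∣)))
         (sym (ℤ.pos-* 2 n)) ⟩
  ∑ᶻ.∑ (λ πs → indicator (admissible? (+ n) k πs)) ts
    ≡⟨ ∑ᶻ.∑-cong ts (λ πs → trans (admissible-indicator n k N πs 2n<N) (∑ᶻ.∑-* (bandTerm k πs) (upTo N) _)) ⟩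
  ∑ᶻ.∑ (λ πs → ∑ᶻ.∑ (λ h → bandTerm k πs h ℤ.* monomial (totalLength πs) L) (upTo N)) ts
    ≡⟨ ∑ᶻ.∑-swap (λ πs h → bandTerm k πs h ℤ.* monomial (totalLength πs) L) ts (upTo N) ⟩
  ∑ᶻ.∑ (λ h → ∑ᶻ.∑ (λ πs → bandTerm k πs h ℤ.* monomial (totalLength πs) L) ts) (upTo N)
    ≡⟨ ∑ᶻ.∑-cong (upTo N) term ⟩
  ∑ᶻ.∑ (λ h → gfTerm (suc m) k h L) (upTo N)
    ≡⟨ ∑-coeff (gfTerm (suc m) k) (upTo N) L ⟨
  ∑ˢ.∑ (gfTerm (suc m) k) (upTo N) L ∎
  where
  open ≡-Reasoning
  L = 2 ℕ.* n
  ts = tuples (suc m) (pathsUpTo L)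
  lemma : ∀ x y z → (x ℤ.- y) ℤ.* z ≡ x ℤ.* z ℤ.- y ℤ.* z
  lemma = solve-∀
  term : ∀ h → ∑ᶻ.∑ (λ πs → bandTerm k πs h ℤ.* monomial (totalLength πs) L) ts ≡ gfTerm (suc m) k h L
  term h = begin
    ∑ᶻ.∑ (λ πs → bandTerm k πs h ℤ.* monomial (totalLength πs) L) ts
      ≡⟨ ∑ᶻ.∑-cong ts (λ πs → lemma (∏ (band h l) πs) (∏ (band (suc h) l) πs) (monomial (totalLength πs) L)) ⟩
    ∑ᶻ.∑ (λ πs → ∏ (band h l) πs ℤ.* monomial (totalLength πs) L
         ℤ.- ∏ (band (suc h) l) πs ℤ.* monomial (totalLength πs) L) ts
      ≡⟨ ∑ᶻ.∑-sub (λ πs → ∏ (band h l) πs ℤ.* monomial (totalLength πs) L)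
         (λ πs → ∏ (band (suc h) l) πs ℤ.* monomial (totalLength πs) L) ts ⟩
    ∑ᶻ.∑ (λ πs → ∏ (band h l) πs ℤ.* monomial (totalLength πs) L) ts
      ℤ.- ∑ᶻ.∑ (λ πs → ∏ (band (suc h) l) πs ℤ.* monomial (totalLength πs) L) ts
      ≡⟨ cong₂ ℤ._-_ (∑-∏-band-coeff h l (suc m) L) (∑-∏-band-coeff (suc h) l (suc m) L) ⟩
    gfTerm (suc m) k h L ∎
    where l = suc (h ℕ.+ k)

-- The two sides differ only in writing h and 1 + h as `h + 0` and `h + 1`.
heightTerm-gf : ∀ h → heightTerm h ≈ gfTerm 3 1 h ⊕ const (+ 2) ⊛ z² ⊛ gfTerm 3 0 h
heightTerm-gf h = SR.reflexive (cong₂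
  (λ b c → ((dyckBelow c ⊕ ⊖ dyckBelow h) ^ 3 ⊕ ⊖ ((dyckBelow c ⊕ ⊖ dyckBelow (suc h)) ^ 3))
     ⊕ const (+ 2) ⊛ z² ⊛ ((dyckBelow b ⊕ ⊖ dyckBelow h) ^ 3 ⊕ ⊖ ((dyckBelow b ⊕ ⊖ dyckBelow (suc h)) ^ 3)))
  (cong suc (sym (ℕ.+-identityʳ h))) (cong suc (ℕ.+-comm 1 h)))

∑-heightTerm-gf : ∀ N → ∑ˢ.∑ heightTerm (upTo N) ≈
  ∑ˢ.∑ (gfTerm 3 1) (upTo N) ⊕ const (+ 2) ⊛ (z² ⊛ ∑ˢ.∑ (gfTerm 3 0) (upTo N))
∑-heightTerm-gf N = begin
  ∑ˢ.∑ heightTerm (upTo N)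
    ≈⟨ ∑ˢ.∑-cong (upTo N) heightTerm-gf ⟩
  ∑ˢ.∑ (λ h → gfTerm 3 1 h ⊕ const (+ 2) ⊛ z² ⊛ gfTerm 3 0 h) (upTo N)
    ≈⟨ ∑ˢ.∑-+ (gfTerm 3 1) (λ h → const (+ 2) ⊛ z² ⊛ gfTerm 3 0 h) (upTo N) ⟩
  ∑ˢ.∑ (gfTerm 3 1) (upTo N) ⊕ ∑ˢ.∑ (λ h → const (+ 2) ⊛ z² ⊛ gfTerm 3 0 h) (upTo N)
    ≈⟨ SR.+-congˡ {∑ˢ.∑ (gfTerm 3 1) (upTo N)} (SR.trans
         (SR.sym (∑ˢ.*-∑ (const (+ 2) ⊛ z²) (gfTerm 3 0) (upTo N)))
         (SR.*-assoc (const (+ 2)) z² (∑ˢ.∑ (gfTerm 3 0) (upTo N)))) ⟩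
  ∑ˢ.∑ (gfTerm 3 1) (upTo N) ⊕ const (+ 2) ⊛ (z² ⊛ ∑ˢ.∑ (gfTerm 3 0) (upTo N)) ∎
  where open import Relation.Binary.Reasoning.Setoid SR.setoid

-- Comparison of T(3, n) with the numbers of tuples.

open import Data.Integer.Base using (_-_)
open import Data.Nat.Base using (_≤_; _+_; _*_)

superCatalan₃-G : ∀ n → superCatalan₃ (suc n) ≡ + (G (+ suc n) 3 1 + 2 * G (+ suc n - 1ℤ) 3 0)
superCatalan₃-G n = begin
  superCatalan₃ (suc n)
    ≡⟨ ∑-heightTerm-coeff n N ℕ.≤-refl ⟨
  ∑ˢ.∑ heightTerm (upTo N) (2 * suc n)
    ≡⟨ coeff (∑-heightTerm-gf N) (2 * suc n) ⟩
  g₁ (2 * suc n) ℤ.+ (const (+ 2) ⊛ (z² ⊛ g₀)) (2 * suc n)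
    ≡⟨ cong (ℤ._+_ (g₁ (2 * suc n))) (trans (const-⊛-coeff (+ 2) (z² ⊛ g₀) (2 * suc n)) (cong (ℤ._*_ (+ 2))
         (trans (cong (z² ⊛ g₀) (ℕ.*-suc 2 n)) (z²-⊛-coeff g₀ (2 * n))))) ⟩
  g₁ (2 * suc n) ℤ.+ + 2 ℤ.* g₀ (2 * n)
    ≡⟨ cong₂ (λ x y → x ℤ.+ + 2 ℤ.* y)
         (G-gf (suc n) 2 1 N (subst (ℕ._< N) (sym (ℕ.*-suc 2 n))
           (ℕ.+-monoˡ-< (2 * n) {2} {7} (s≤s (s≤s (s≤s z≤n))))))
         (G-gf n 2 0 N (ℕ.m<n+m (2 * n) {7} (s≤s z≤n))) ⟨
  + G (+ suc n) 3 1 ℤ.+ + 2 ℤ.* + G (+ n) 3 0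
    ≡⟨ cong (ℤ._+_ (+ G (+ suc n) 3 1)) (sym (ℤ.pos-* 2 (G (+ n) 3 0))) ⟩
  -- The index `+ suc n - 1ℤ` of the statement evaluates to `+ n`.
  + (G (+ suc n) 3 1 + 2 * G (+ n) 3 0) ∎
  where
  open ≡-Reasoning
  -- The least N allowed by `∑-heightTerm-coeff`; it also exceeds both path lengths 2n + 2 and 2n.
  N = 7 + 2 * n
  g₁ = ∑ˢ.∑ (gfTerm 3 1) (upTo N)
  g₀ = ∑ˢ.∑ (gfTerm 3 0) (upTo N)

theorem1 : (n : ℕ) → 1 ≤ n → T 3 n ≡ + (G (+ n) 3 1 + 2 * G (+ n - 1ℤ) 3 0) / 1
theorem1 (suc n) _ = trans (T₃-superCatalan₃ (suc n)) (cong (_/ 1) (superCatalan₃-G n))
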